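{- Let $T$ be a complete first-order theory, $k<\omega$, and $m,n\le\omega$. (1) If $T$ fails $(k,\ m\text{ -strongly bi-invariant},\ n\text{ -strongly bi-invariant})$--Kim's lemma, then $T$ has a $(k,m,n)$-weave of depth $\omega$. (2) If $T$ fails $(k,\ m\text{ -strongly bi-invariant},\ \text{semi-reliably invariant})$--Kim's lemma, then $T$ has a $(k,m,1)$-weave of depth $\omega$. (3) If $T$ fails $(k,\ \text{semi-reliably invariant},\ n\text{ -strongly bi-invariant})$--Kim's lemma, then $T$ has a $(k,1,n)$-weave of depth $\omega$. (4) If $T$ fails $(k,\ \text{semi-reliably invariant},\ \text{semi-reliably invariant})$--Kim's lemma, then $T$ has a $(k,1,1)$-weave of depth $\omega$.
   Context: Work in a monster model $\mathbb{M}$ of $T$; parameter sets $A$ are small. A global type $p$ is $A$-invariant if it is fixed by automorphisms of $\mathbb{M}$ fixing $A$. For a global $A$-invariant $p(y)$, a Morley sequence in $p$ over $A$ is $(b_i)_{i<\omega}$ with $b_i\models p|_{Ab_{<i}}$; $p^{\otimes n}$ is the global type of such a sequence of length $n$ over $\mathbb{M}$ (realizations taken in a bigger model). For $b$ with $p\supseteq\mathrm{tp}(b/A)$, $\varphi(x,b)$ $k$-divides along $p$ if $\{\varphi(x,b_i):i<\omega\}$ is $k$-inconsistent for a (any) Morley sequence $(b_i)$ in $p$ over $A$, and divides along $p$ if this set is inconsistent. $c\mathop{\smile\!\!\!\!\!\mid}^i_A b$ means $\mathrm{tp}(c/Ab)$ extends to a global $A$-invariant type. $p$ is $A$-bi-invariant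 if whenever $b\models p|_{Ac}$ we have $c\mathop{\smile\!\!\!\!\!\mid}^i_A b$; $p$ is $n$-strongly $A$-bi-invariant if $p^{\otimes n}$ is $A$-bi-invariant (for $n=\omega$ the type of an $\omega$-length Morley sequence). A sequence $(b_i:i<n)$ is an invariant sequence over $A$ if $b_i\equiv_A b_j$ for all $i<j<n$ and $b_i\mathop{\smile\!\!\!\!\!\mid}^i_A b_{<i}$ for all $i<n$. A global $A$-invariant type $p$ is semi-reliably $A$-invariant if it belongs to the largest class $\mathcal{R}$ of global $A$-invariant types (in arbitrary tuples of variables) such that for any $p(x_0)\in\mathcal R$, any $n$, and any $q(x_0,\dots,x_{n-1})\in S(A)$ extending $(p|_A)(x_0)$ which is the type of an invariant sequence over $A$, there is $r(x_0,\dots,x_{n-1})\in\mathcal R$ extending $p(x_0)\cup\dots\cup p(x_{n-1})\cup q(x_0,\dots,x_{n-1})$. For classes $\mathcal X,\mathcal Y$ of pairs $(A,p)$ ($p$ global $A$-invariant) and $k<\omega$, $T$ satisfies $(k,\mathcal X,\mathcal Y)$--Kim's lemma if for every $A$, formula $\varphi(x,b)$, and $p,q\supseteq\mathrm{tp}(b/A)$ with $(A,p)\in\mathcal X$, $(A,q)\in\mathcal Y$: if $\varphi(x,b)$ $k$-divides along $p$ then it divides along $q$. A class name like "$m$-strongly bi-invariant" means the class of $(A,p)$ with $p$ $m$-strongly $A$-bi-invariant, etc. Weaves: $2^2=\{0,1\}^2$; $(2^2)^\omega$ is the set of functions $\omega\to2^2$ and $(2^2)^{<\omega}$ the finite sequences;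 for $\tau\in(2^2)^{<\omega}$, $a\in2^2$, $\tau^\frown a$ is concatenation. For $A,B\subseteq(2^2)^\omega$: $A$ is narrowly below $B$ if there are $\tau\in(2^2)^{<\omega}$, $i<2$ with all elements of $A$ extending $\tau^\frown(i,0)$ and all of $B$ extending $\tau^\frown(i,1)$; $A$ is narrowly to the left of $B$ if there are $\tau$, $j<2$ with all elements of $A$ extending $\tau^\frown(0,j)$ and all of $B$ extending $\tau^\frown(1,j)$. For $n\le\omega$, finite up-$n$-combs: smallest class of finite subsets containing singletons such that if $A,B$ are finite up-$n$-combs, $|A|\le n$, $A$ narrowly below $B$, then $A\cup B$ is one; finite right-$n$-combs likewise with "narrowly to the left of". A $(k,m,n)$-weave of depth $\omega$ is a formula $\varphi(x,y)$ and parameters $(b_\sigma:\sigma\in(2^2)^\omega)$ such that $\{\varphi(x,b_\sigma):\sigma\in C\}$ is $k$-inconsistent for every finite up-$m$-comb $C$ and consistent for every finite right-$n$-comb $C$. -}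

module Defs where

open import Level using (Level; _⊔_) renaming (suc to lsuc)
open import Data.Empty using (⊥)
import Data.Empty.Polymorphic as Poly
open import Data.Unit using (⊤)
open import Data.Nat using (ℕ; suc; _<_; _≤_)
open import Data.Fin using (Fin; toℕ)
open import Data.Fin.Patterns using (0F; 1F)
open import Data.Maybe using (Maybe; maybe′) renaming (map to mapMaybe)
open import Data.List using (List; []; _∷_; [_]; _++_; length; applyUpTo)
open import Data.List.Membership.Propositional using (_∈_)
open import Data.List.Relation.Unary.All using (All)
open import Data.List.Relation.Unary.Unique.Propositional using (Unique)
open import Data.Vec using (Vec; []; _∷_) renaming (map to mapVec)
open import Data.Product using (Σ-syntax; ∃-syntax; _×_; _,_)
open import Data.Sum using (_⊎_; [_,_]′; map₁; map₂)
open import Function using (_∘_; id; _⇔_; _↔_; Inverse)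
open import Relation.Nullary using (¬_)
open import Relation.Unary using (Pred; _⊆_; _≐_; U)
open import Relation.Binary.PropositionalEquality using (_≡_)

record Language (ℓ : Level) : Set (lsuc ℓ) where
  field
    Func : ℕ → Set ℓ
    Rel  : ℕ → Set ℓ

open Language

module _ {ℓ : Level} (L : Language ℓ) where

  data Term {v} (V : Set v) : Set (ℓ ⊔ v) where
    var : V → Term V
    app : ∀ {n} → Func L n → Vec (Term V) n → Term V

  -- Formulas whose free variables are taken from V; the bound variable of
  -- `all` is `nothing`.  The remaining connectives are the classical
  -- abbreviations.
  data Formula {v} (V : Set v) : Set (ℓ ⊔ v) where
    fls  : Formula V
    _≈_  : Term V → Term V → Formula V
    rel  : ∀ {n} → Rel L n → Vec (Term V) n → Formula V
    _⇒_  : Formula V → Formula V → Formula V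
    all  : Formula (Maybe V) → Formula V

  Sentence : Set ℓ
  Sentence = Formula ⊥

  Theory : Set (lsuc (lsuc ℓ))
  Theory = Pred Sentence (lsuc ℓ)

  -- "Small" means indexed by a type in Set ℓ.  Carriers live one universe
  -- higher, so that a structure can be saturated with respect to all small
  -- sets (Set ℓ plays the role of an inaccessible cardinal bounding |L|).
  record Structure : Set (lsuc (lsuc ℓ)) where
    field
      Carrier  : Set (lsuc ℓ)
      nonEmpty : Carrier
      fun⟦_⟧   : ∀ {n} → Func L n → Vec Carrier n → Carrier
      rel⟦_⟧   : ∀ {n} → Rel L n → Vec Carrier n → Set (lsuc ℓ)

open Structure

module _ {ℓ : Level} {L : Language ℓ} where

  not : ∀ {v} {V : Set v} → Formula L V → Formula L V
  not φ = φ ⇒ fls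

  module _ {v w} {V : Set v} {W : Set w} (f : V → W) where
    renameTerm  : Term L V → Term L W
    renameTerms : ∀ {n} → Vec (Term L V) n → Vec (Term L W) n
    renameTerm (var x)    = var (f x)
    renameTerm (app g ts) = app g (renameTerms ts)
    renameTerms []       = []
    renameTerms (t ∷ ts) = renameTerm t ∷ renameTerms ts

  rename : ∀ {v w} {V : Set v} {W : Set w} → (V → W) → Formula L V → Formula L W
  rename f fls        = fls
  rename f (s ≈ t)    = renameTerm f s ≈ renameTerm f t
  rename f (rel R ts) = rel R (renameTerms f ts)
  rename f (φ ⇒ ψ)    = rename f φ ⇒ rename f ψ
  rename f (all φ)    = all (rename (mapMaybe f) φ)

  module _ (N : Structure L) {v} {V : Set v} (e : V → Carrier N) where
    evalTerm  : Term L V → Carrier N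
    evalTerms : ∀ {n} → Vec (Term L V) n → Vec (Carrier N) n
    evalTerm (var x)    = e x
    evalTerm (app g ts) = fun⟦_⟧ N g (evalTerms ts)
    evalTerms []       = []
    evalTerms (t ∷ ts) = evalTerm t ∷ evalTerms ts

  infix 4 _⊨_[_] _⊨ₛ_ _⊨ₜ_

  _⊨_[_] : ∀ (N : Structure L) {v} {V : Set v} → Formula L V → (V → Carrier N) → Set (lsuc ℓ)
  N ⊨ fls      [ e ] = Poly.⊥
  N ⊨ s ≈ t    [ e ] = evalTerm N e s ≡ evalTerm N e t
  N ⊨ rel R ts [ e ] = rel⟦_⟧ N R (evalTerms N e ts)
  N ⊨ φ ⇒ ψ    [ e ] = N ⊨ φ [ e ] → N ⊨ ψ [ e ]
  N ⊨ all φ    [ e ] = ∀ x → N ⊨ φ [ maybe′ e x ]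

  _⊨ₛ_ : Structure L → Sentence L → Set (lsuc ℓ)
  N ⊨ₛ σ = N ⊨ σ [ (λ ()) ]

  _⊨ₜ_ : Structure L → Theory L → Set (lsuc ℓ)
  N ⊨ₜ T = ∀ σ → T σ → N ⊨ₛ σ

  Entails : Theory L → Sentence L → Set (lsuc (lsuc ℓ))
  Entails T σ = ∀ N → N ⊨ₜ T → N ⊨ₛ σ

  record Complete (T : Theory L) : Set (lsuc (lsuc ℓ)) where
    field
      consistent : ∃[ N ] N ⊨ₜ T
      decides    : ∀ σ → Entails T σ ⊎ Entails T (not σ)

  -- A formula over V ⊎ J together with c : J → Carrier N is a formula in the
  -- variables V with parameters from the family c.
  module _ (N : Structure L) where

    tp : ∀ {v j} {V : Set v} {J : Set j} →
         (V → Carrier N) → (J → Carrier N) → Pred (Formula L (V ⊎ J)) (lsuc ℓ)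
    tp b c φ = N ⊨ φ [ [ b , c ]′ ]

    FinitelySatisfiable : ∀ {v j} {V : Set v} {J : Set j} →
      (J → Carrier N) → Pred (Formula L (V ⊎ J)) (lsuc ℓ) → Set (lsuc ℓ ⊔ v ⊔ j)
    FinitelySatisfiable {V = V} c q =
      ∀ φs → All q φs → Σ[ b ∈ (V → Carrier N) ] All (tp b c) φs

    record IsType {v j} {V : Set v} {J : Set j} (c : J → Carrier N)
                  (q : Pred (Formula L (V ⊎ J)) (lsuc ℓ)) : Set (lsuc ℓ ⊔ v ⊔ j) where
      field
        finSat   : FinitelySatisfiable c q
        complete : ∀ φ → q φ ⊎ q (not φ)

    record Automorphism : Set (lsuc ℓ) where
      field
        bij      : Carrier N ↔ Carrier N
      open Inverse bij using (to) public
      field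
        fun-comm : ∀ {n} (g : Func L n) xs → to (fun⟦_⟧ N g xs) ≡ fun⟦_⟧ N g (mapVec to xs)
        rel-comm : ∀ {n} (R : Rel L n) xs → rel⟦_⟧ N R xs ⇔ rel⟦_⟧ N R (mapVec to xs)

    record IsMonster : Set (lsuc (lsuc ℓ)) where
      field
        saturated   : ∀ {V J : Set ℓ} (c : J → Carrier N) (q : Pred (Formula L (V ⊎ J)) (lsuc ℓ)) →
                      FinitelySatisfiable c q → Σ[ b ∈ (V → Carrier N) ] q ⊆ tp b c
        homogeneous : ∀ {V : Set ℓ} (b b' : V → Carrier N) →
                      (∀ (φ : Formula L V) → N ⊨ φ [ b ] ⇔ N ⊨ φ [ b' ]) →
                      Σ[ f ∈ Automorphism ] ∀ x → Automorphism.to f (b x) ≡ b' x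

  record ElementaryExtension (M : Structure L) : Set (lsuc (lsuc ℓ)) where
    field
      big        : Structure L
      ι          : Carrier M → Carrier big
      elementary : ∀ {n} (φ : Formula L (Fin n)) e → M ⊨ φ [ e ] ⇔ big ⊨ φ [ ι ∘ e ]

data Length : Set where
  fin : ℕ → Length
  ω   : Length

Position : Length → Set
Position (fin n) = Fin n
Position ω       = ℕ

index : ∀ {n} → Position n → ℕ
index {fin n} i = toℕ i
index {ω}     i = i

Before : ∀ {n} → Position n → Set
Before {n} i = Σ[ j ∈ Position n ] index {n} j < index {n} i

_≤ᴸ_ : ℕ → Length → Set
k ≤ᴸ fin n = k ≤ n
k ≤ᴸ ω     = ⊤

initial : ∀ {n v c} {V : Set v} {C : Set c} →
          (Position n → V → C) → (i : Position n) → Before {n} i × V → C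
initial b i ((j , _) , y) = b j y

module _ {ℓ : Level} {L : Language ℓ} (M : Structure L) where

  GlobalPred : Set ℓ → Set (lsuc (lsuc ℓ))
  GlobalPred V = Pred (Formula L (V ⊎ Carrier M)) (lsuc ℓ)

  infixl 7 _↾_
  _↾_ : ∀ {j} {V : Set ℓ} {J : Set j} → GlobalPred V → (J → Carrier M) → Pred (Formula L (V ⊎ J)) (lsuc ℓ)
  (p ↾ c) φ = p (rename (map₂ c) φ)

  record InvariantType {I : Set ℓ} (a : I → Carrier M) (V : Set ℓ) : Set (lsuc (lsuc ℓ)) where
    field
      pred      : GlobalPred V
      isType    : IsType M id pred
      invariant : ∀ (f : Automorphism M) → (let open Automorphism f) →
                  (∀ i → to (a i) ≡ a i) → ∀ φ → pred φ ⇔ pred (rename (map₂ to) φ)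

  open InvariantType

  -- c ⫝ⁱ_a b
  InvIndep : ∀ {I J W : Set ℓ} → (J → Carrier M) → (I → Carrier M) → (W → Carrier M) → Set (lsuc (lsuc ℓ))
  InvIndep {J = J} c a b = Σ[ P ∈ InvariantType a J ] tp M c [ a , b ]′ ⊆ pred P ↾ [ a , b ]′

  module _ {I : Set ℓ} {a : I → Carrier M} {V : Set ℓ} where

    MorleySequence : InvariantType a V → (ℕ → V → Carrier M) → Set (lsuc ℓ)
    MorleySequence p b =
      ∀ i → let c = [ a , initial {ω} b i ]′ in pred p ↾ c ⊆ tp M (b i) c

    BiInvariant : InvariantType a V → Set (lsuc (lsuc ℓ))
    BiInvariant p = ∀ {J : Set ℓ} (c : J → Carrier M) (b : V → Carrier M) →
                    (let ac = [ a , c ]′) → pred p ↾ ac ⊆ tp M b ac → InvIndep c a b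

    module _ (p : InvariantType a V) (E : ElementaryExtension M) where
      open ElementaryExtension E

      -- φ(x,d) belongs to the canonical extension of p to `big`: φ(x,d′) ∈ p
      -- for d′ in M with the same type over a as d.
      InExtension : ∀ {k} → Formula L (V ⊎ Fin k) → (Fin k → Carrier big) → Set (lsuc ℓ)
      InExtension {k} φ d = Σ[ d′ ∈ (Fin k → Carrier M) ]
        (tp M d′ a ≐ tp big d (ι ∘ a)) × pred p (rename (map₂ d′) φ)

      MorleySequenceOverM : ∀ n → (Position n → V → Carrier big) → Set (lsuc ℓ)
      MorleySequenceOverM n b =
        ∀ i {k} (φ : Formula L (V ⊎ Fin k)) (e : Fin k → Carrier M ⊎ (Before {n} i × V)) →
        let d = [ ι , initial {n} b i ]′ ∘ e in InExtension φ d → tp big (b i) d φ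

  -- r = p^{⊗n}.  It is the type over M of a Morley sequence lying in a bigger
  -- model; since r is unique up to logical equivalence and always exists, the
  -- definition of n-strong bi-invariance may use "some r".
  IsPower : ∀ {I V : Set ℓ} {a : I → Carrier M} → InvariantType a V → (n : Length) →
            InvariantType a (Position n × V) → Set (lsuc (lsuc ℓ))
  IsPower {V = V} p n r = Σ[ E ∈ ElementaryExtension M ] let open ElementaryExtension E in
    Σ[ b ∈ (Position n → V → Carrier big) ]
      MorleySequenceOverM p E n b × (pred r ≐ tp big (λ (i , y) → b i y) ι)

  Class : ∀ s → Set (lsuc (lsuc ℓ) ⊔ lsuc s)
  Class s = ∀ {I : Set ℓ} {a : I → Carrier M} {V : Set ℓ} → InvariantType a V → Set s

  StronglyBiInvariant : Length → Class (lsuc (lsuc ℓ))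
  StronglyBiInvariant n {a = a} {V = V} p =
    Σ[ r ∈ InvariantType a (Position n × V) ] IsPower p n r × BiInvariant r

  module _ {I : Set ℓ} (a : I → Carrier M) where

    InvariantSequence : ∀ {V : Set ℓ} n → (Fin n → V → Carrier M) → Set (lsuc (lsuc ℓ))
    InvariantSequence n b =
      (∀ i j → toℕ i < toℕ j → tp M (b i) a ≐ tp M (b j) a) ×
      (∀ i → InvIndep (b i) a (initial {fin n} b i))

    -- The closure condition on a class R of global a-invariant types; the
    -- sequences (x₀,…,xₙ₋₁) have length suc n here, as x₀ must exist.
    SemiReliablyClosed : (∀ {V : Set ℓ} → InvariantType a V → Set (lsuc (lsuc ℓ))) → Set (lsuc (lsuc ℓ))
    SemiReliablyClosed R =
      ∀ {V : Set ℓ} (p : InvariantType a V) → R p →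
      ∀ n (q : Pred (Formula L ((Fin (suc n) × V) ⊎ I)) (lsuc ℓ)) → IsType M a q →
      (∀ φ → (pred p ↾ a) φ → q (rename (map₁ (0F ,_)) φ)) →
      (Σ[ b ∈ (Fin (suc n) → V → Carrier M) ]
         InvariantSequence (suc n) b × (q ≐ tp M (λ (i , y) → b i y) a)) →
      Σ[ r ∈ InvariantType a (Fin (suc n) × V) ]
        R r ×
        (∀ i φ → pred p φ → pred r (rename (map₁ (i ,_)) φ)) ×
        (q ⊆ pred r ↾ a)

  -- Closed classes are stable under union, so the largest one consists of the
  -- types belonging to some closed class.
  SemiReliable : Class (lsuc (lsuc (lsuc ℓ)))
  SemiReliable {a = a} p =
    Σ[ R ∈ (∀ {V : Set ℓ} → InvariantType a V → Set (lsuc (lsuc ℓ))) ] SemiReliablyClosed a R × R p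

  module _ {s y} {S : Set s} {Y : Set y} {m} (φ : Formula L (Fin m ⊎ Y)) (b : S → Y → Carrier M) where

    Satisfied : List S → Set (lsuc ℓ ⊔ s)
    Satisfied is = Σ[ x ∈ (Fin m → Carrier M) ] All (λ i → M ⊨ φ [ [ x , b i ]′ ]) is

    Consistent : ∀ {d} → Pred S d → Set (lsuc ℓ ⊔ s ⊔ d)
    Consistent D = ∀ is → All D is → Satisfied is

    -- Indices are counted, not formulas: repetitions among the bᵢ are allowed.
    KInconsistent : ∀ {d} → ℕ → Pred S d → Set (lsuc ℓ ⊔ s ⊔ d)
    KInconsistent k D = ∀ is → Unique is → length is ≡ k → All D is → ¬ Satisfied is

  module _ {I V : Set ℓ} {a : I → Carrier M} {m} (φ : Formula L (Fin m ⊎ V)) (p : InvariantType a V) where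

    KDividesAlong : ℕ → Set (lsuc ℓ)
    KDividesAlong k = Σ[ b ∈ (ℕ → V → Carrier M) ] MorleySequence p b × KInconsistent φ b k U

    DividesAlong : Set (lsuc ℓ)
    DividesAlong = Σ[ b ∈ (ℕ → V → Carrier M) ] MorleySequence p b × ¬ Consistent φ b U

  KimsLemma : ∀ {s t} → ℕ → Class s → Class t → Set (lsuc (lsuc ℓ) ⊔ s ⊔ t)
  KimsLemma k 𝒳 𝒴 =
    ∀ {I : Set ℓ} (a : I → Carrier M) {m} {V : Set ℓ} (φ : Formula L (Fin m ⊎ V)) (b : V → Carrier M)
      (p q : InvariantType a V) → tp M b a ⊆ pred p ↾ a → tp M b a ⊆ pred q ↾ a →
    𝒳 p → 𝒴 q → KDividesAlong φ p k → DividesAlong φ q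

2² : Set
2² = Fin 2 × Fin 2

2²^ω : Set
2²^ω = ℕ → 2²

_Extends_ : 2²^ω → List 2² → Set
σ Extends τ = applyUpTo σ (length τ) ≡ τ

-- Finite subsets of 2²^ω are given by lists.  The sets joined in a comb are
-- disjoint, so combs are duplicate-free and `length` is the cardinality.

NarrowlyBelow : List 2²^ω → List 2²^ω → Set
NarrowlyBelow A B = Σ[ τ ∈ List 2² ] Σ[ i ∈ Fin 2 ]
  All (_Extends (τ ++ [ (i , 0F) ])) A × All (_Extends (τ ++ [ (i , 1F) ])) B

NarrowlyLeft : List 2²^ω → List 2²^ω → Set
NarrowlyLeft A B = Σ[ τ ∈ List 2² ] Σ[ j ∈ Fin 2 ]
  All (_Extends (τ ++ [ (0F , j) ])) A × All (_Extends (τ ++ [ (1F , j) ])) B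

data Comb (_◁_ : List 2²^ω → List 2²^ω → Set) (n : Length) : List 2²^ω → Set where
  singleton : ∀ σ → Comb _◁_ n [ σ ]
  join      : ∀ {A B} → Comb _◁_ n A → Comb _◁_ n B → length A ≤ᴸ n → A ◁ B → Comb _◁_ n (A ++ B)

UpComb RightComb : Length → List 2²^ω → Set
UpComb    = Comb NarrowlyBelow
RightComb = Comb NarrowlyLeft

record Weave {ℓ} {L : Language ℓ} (M : Structure L) (k : ℕ) (m n : Length) : Set (lsuc ℓ) where
  field
    {xs ys} : ℕ
    φ       : Formula L (Fin xs ⊎ Fin ys)
    b       : 2²^ω → Fin ys → Carrier M
    up      : ∀ C → UpComb m C → KInconsistent M φ b k (_∈ C)
    right   : ∀ C → RightComb n C → Consistent M φ b (_∈ C)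

{-# OPTIONS --safe #-}

-- Trees (b_σ) of realizations of tp(b/A) are built by alternately doubling them
-- vertically and horizontally, so that every up-comb, read from its last member
-- to its first, is a Morley sequence in p over A, and every right-comb one in q.
-- Doubling a tuple z vertically means finding an invariant sequence of two copies
-- of z such that short Morley sequences in p from the lower copy stay Morley over
-- the upper one.
--
-- If r = p^{⊗m} is A-bi-invariant, let c ⊨ r|_{Az} and let t be a global
-- A-invariant extension of tp(z/Ac); the lower copy is z and the upper one is
-- d ⊨ t|_{Az}.  A Morley sequence e in z of length at most m has the type over A of
-- an initial segment of c, hence, t being A-invariant, (d,e) has the type of
-- (z,c), and e is Morley over d.  Nothing has to be assumed about z.
--
-- If p is semi-reliable, one carries along a semi-reliable P ⊇ tp(z/A) that
-- restricts to p on every b_σ; the upper copy is z and the lower one realizes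
-- P|_{Az}.  Semi-reliability extends P to the doubled tuple, whichever of the two
-- types it was doubled for, because the two copies form an invariant sequence.
--
-- Trees of all finite depths give one of depth ω by saturation.

module Submission where

open import Defs
open import Level using (Level; _⊔_) renaming (suc to lsuc)
open import Axiom.ExcludedMiddle using (ExcludedMiddle)
open import Data.Empty using (⊥-elim)
import Data.Empty.Polymorphic as Poly
open import Data.Nat using (ℕ; zero; suc; _+_; _≤_; _<_; s≤s) renaming (_⊔_ to _⊔ₙ_)
open import Data.Nat.Properties using (≤-refl; ≤-reflexive; ≤-trans; m<n⇒m<1+n; n≤1+n; ≤∧≢⇒<; ≤-pred; _≟_; n<1+n; <⇒≢; suc-injective; m≤m⊔n; m≤n⊔m)
open import Data.Fin using (Fin; _↑ˡ_; _↑ʳ_; splitAt; fromℕ<; opposite)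
open import Data.Fin.Properties using (splitAt-↑ˡ; splitAt-↑ʳ; toℕ-fromℕ<)
open import Data.Fin.Patterns using (0F; 1F)
open import Data.Maybe using (Maybe; just; nothing; maybe′) renaming (map to mapMaybe)
open import Data.Vec using (Vec; []; _∷_) renaming (map to mapVec)
open import Data.List using (List; []; _∷_; [_]; _++_; length; map)
open import Data.List.Relation.Unary.All using (All; []; _∷_)
import Data.List.Relation.Unary.All as All
import Data.List.Relation.Unary.All.Properties as All
open import Data.List.Relation.Unary.Any using (Any; here; there)
import Data.List.Relation.Unary.Any.Properties as Any
open import Data.List.Membership.Propositional using (_∈_)
open import Data.List.Properties using (∷-injective; map-++; length-map)
open import Data.List.Relation.Unary.AllPairs using ([]; _∷_)
open import Data.List.Relation.Unary.Unique.Propositional using (Unique)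
open import Data.List.Relation.Binary.Pointwise using (Pointwise; []; _∷_; Pointwise-length)
import Data.List.Relation.Binary.Pointwise as Pointwise
open import Data.Product using (Σ-syntax; ∃-syntax; _×_; _,_; proj₁; proj₂; uncurry)
open import Data.Sum using (_⊎_; inj₁; inj₂; [_,_]′; map₁; map₂)
open import Data.Unit using (tt)
import Data.Unit.Polymorphic as Poly
open import Function using (case_of_; _∘_; id; _⇔_; mk⇔; Equivalence; Inverse)
open import Relation.Nullary using (¬_; yes; no)
open import Relation.Unary using (Pred; _⊆_; _≐_; _∪_; U)
open import Relation.Binary.PropositionalEquality using (_≡_; _≢_; refl; sym; trans; cong; cong₂; subst; _≗_)

open Structure
open Equivalence using (to; from)
open InvariantType

-- Renaming of variables, evaluation, and invariance of truth under automorphisms.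

module _ {ℓ : Level} {L : Language ℓ} where

  private variable
    v w x : Level
    V : Set v
    W : Set w
    X : Set x

  module _ {f g : V → W} (f≗g : f ≗ g) where
    renameTerm-cong  : renameTerm {L = L} f ≗ renameTerm g
    renameTerms-cong : ∀ {n} → renameTerms {L = L} f {n} ≗ renameTerms g
    renameTerm-cong (var y)    = cong var (f≗g y)
    renameTerm-cong (app h ts) = cong (app h) (renameTerms-cong ts)
    renameTerms-cong []       = refl
    renameTerms-cong (t ∷ ts) = cong₂ _∷_ (renameTerm-cong t) (renameTerms-cong ts)

  mapMaybe-cong : {f g : V → W} → f ≗ g → mapMaybe f ≗ mapMaybe g
  mapMaybe-cong f≗g nothing  = refl
  mapMaybe-cong f≗g (just y) = cong just (f≗g y)

  rename-cong : {f g : V → W} → f ≗ g → rename {L = L} f ≗ rename g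
  rename-cong f≗g fls        = refl
  rename-cong f≗g (s ≈ t)    = cong₂ _≈_ (renameTerm-cong f≗g s) (renameTerm-cong f≗g t)
  rename-cong f≗g (rel R ts) = cong (rel R) (renameTerms-cong f≗g ts)
  rename-cong f≗g (φ ⇒ ψ)    = cong₂ _⇒_ (rename-cong f≗g φ) (rename-cong f≗g ψ)
  rename-cong f≗g (all φ)    = cong all (rename-cong (mapMaybe-cong f≗g) φ)

  module _ (f : W → X) (g : V → W) where
    renameTerm-∘  : (t : Term L V) → renameTerm f (renameTerm g t) ≡ renameTerm (f ∘ g) t
    renameTerms-∘ : ∀ {n} (ts : Vec (Term L V) n) →
                    renameTerms f (renameTerms g ts) ≡ renameTerms (f ∘ g) ts
    renameTerm-∘ (var y)    = refl
    renameTerm-∘ (app h ts) = cong (app h) (renameTerms-∘ ts)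
    renameTerms-∘ []       = refl
    renameTerms-∘ (t ∷ ts) = cong₂ _∷_ (renameTerm-∘ t) (renameTerms-∘ ts)

  mapMaybe-∘ : (f : W → X) (g : V → W) → mapMaybe f ∘ mapMaybe g ≗ mapMaybe (f ∘ g)
  mapMaybe-∘ f g nothing  = refl
  mapMaybe-∘ f g (just y) = refl

  rename-∘ : (f : W → X) (g : V → W) (φ : Formula L V) → rename f (rename g φ) ≡ rename (f ∘ g) φ
  rename-∘ f g fls        = refl
  rename-∘ f g (s ≈ t)    = cong₂ _≈_ (renameTerm-∘ f g s) (renameTerm-∘ f g t)
  rename-∘ f g (rel R ts) = cong (rel R) (renameTerms-∘ f g ts)
  rename-∘ f g (φ ⇒ ψ)    = cong₂ _⇒_ (rename-∘ f g φ) (rename-∘ f g ψ)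
  rename-∘ f g (all φ)    = cong all (trans (rename-∘ _ _ φ) (rename-cong (mapMaybe-∘ f g) φ))

  renameTerm-id  : (t : Term L V) → renameTerm id t ≡ t
  renameTerms-id : ∀ {n} (ts : Vec (Term L V) n) → renameTerms id ts ≡ ts
  renameTerm-id (var y)    = refl
  renameTerm-id (app h ts) = cong (app h) (renameTerms-id ts)
  renameTerms-id []       = refl
  renameTerms-id (t ∷ ts) = cong₂ _∷_ (renameTerm-id t) (renameTerms-id ts)

  mapMaybe-id : mapMaybe {A = V} id ≗ id
  mapMaybe-id nothing  = refl
  mapMaybe-id (just y) = refl

  rename-id : (φ : Formula L V) → rename id φ ≡ φ
  rename-id fls        = refl
  rename-id (s ≈ t)    = cong₂ _≈_ (renameTerm-id s) (renameTerm-id t)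
  rename-id (rel R ts) = cong (rel R) (renameTerms-id ts)
  rename-id (φ ⇒ ψ)    = cong₂ _⇒_ (rename-id φ) (rename-id ψ)
  rename-id (all φ)    = cong all (trans (rename-cong mapMaybe-id φ) (rename-id φ))

  rename-≗ : {f : W → X} {g : V → W} {h : V → X} → f ∘ g ≗ h → (φ : Formula L V) →
             rename f (rename g φ) ≡ rename h φ
  rename-≗ f∘g≗h φ = trans (rename-∘ _ _ φ) (rename-cong f∘g≗h φ)

  renameTerms-≗ : ∀ {n} {f : W → X} {g : V → W} {h : V → X} → f ∘ g ≗ h → (ts : Vec (Term L V) n) →
                  renameTerms f (renameTerms g ts) ≡ renameTerms h ts
  renameTerms-≗ f∘g≗h ts = trans (renameTerms-∘ _ _ ts) (renameTerms-cong f∘g≗h ts)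

  renameTerm-≗ : {f : W → X} {g : V → W} {h : V → X} → f ∘ g ≗ h → (t : Term L V) →
                 renameTerm f (renameTerm g t) ≡ renameTerm h t
  renameTerm-≗ f∘g≗h t = trans (renameTerm-∘ _ _ t) (renameTerm-cong f∘g≗h t)

  module _ (N : Structure L) {f : V → W} {e : W → Carrier N} {e' : V → Carrier N} (e∘f≗e' : e ∘ f ≗ e') where
    evalTerm-rename  : (t : Term L V) → evalTerm N e (renameTerm f t) ≡ evalTerm N e' t
    evalTerms-rename : ∀ {n} (ts : Vec (Term L V) n) → evalTerms N e (renameTerms f ts) ≡ evalTerms N e' ts
    evalTerm-rename (var y)    = e∘f≗e' y
    evalTerm-rename (app h ts) = cong (fun⟦_⟧ N h) (evalTerms-rename ts)
    evalTerms-rename []       = refl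
    evalTerms-rename (t ∷ ts) = cong₂ _∷_ (evalTerm-rename t) (evalTerms-rename ts)

  maybe′-mapMaybe : ∀ {c} {C : Set c} {f : V → W} {e : W → C} {e' : V → C} → e ∘ f ≗ e' →
                    ∀ y → maybe′ e y ∘ mapMaybe f ≗ maybe′ e' y
  maybe′-mapMaybe e∘f≗e' y nothing  = refl
  maybe′-mapMaybe e∘f≗e' y (just z) = e∘f≗e' z

  ⊨-rename : (N : Structure L) {f : V → W} {e : W → Carrier N} {e' : V → Carrier N} → e ∘ f ≗ e' →
             (φ : Formula L V) → N ⊨ rename f φ [ e ] ⇔ N ⊨ φ [ e' ]
  ⊨-rename N eq fls = mk⇔ id id
  ⊨-rename N eq (s ≈ t) = mk⇔
    (λ h → trans (sym (evalTerm-rename N eq s)) (trans h (evalTerm-rename N eq t)))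
    (λ h → trans (evalTerm-rename N eq s) (trans h (sym (evalTerm-rename N eq t))))
  ⊨-rename N eq (rel R ts) = mk⇔
    (subst (rel⟦_⟧ N R) (evalTerms-rename N eq ts))
    (subst (rel⟦_⟧ N R) (sym (evalTerms-rename N eq ts)))
  ⊨-rename N eq (φ ⇒ ψ) = mk⇔
    (λ h → to (⊨-rename N eq ψ) ∘ h ∘ from (⊨-rename N eq φ))
    (λ h → from (⊨-rename N eq ψ) ∘ h ∘ to (⊨-rename N eq φ))
  ⊨-rename N eq (all φ) = mk⇔
    (λ h y → to (⊨-rename N (maybe′-mapMaybe eq y) φ) (h y))
    (λ h y → from (⊨-rename N (maybe′-mapMaybe eq y) φ) (h y))

  module _ {N : Structure L} (F : Automorphism N) where
    private module F = Automorphism F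

    private
      from′ : Carrier N → Carrier N
      from′ = Inverse.from F.bij

      to-from : ∀ y → F.to (from′ y) ≡ y
      to-from y = Inverse.inverseˡ F.bij refl

      to-injective : ∀ {y z} → F.to y ≡ F.to z → y ≡ z
      to-injective eq = trans (sym (Inverse.inverseʳ F.bij refl))
                              (trans (cong from′ eq) (Inverse.inverseʳ F.bij refl))

    module _ {e e' : V → Carrier N} (eq : F.to ∘ e ≗ e') where
      automorphism-evalTerm  : ∀ t → F.to (evalTerm N e t) ≡ evalTerm N e' t
      automorphism-evalTerms : ∀ {n} (ts : Vec (Term L V) n) →
                               mapVec F.to (evalTerms N e ts) ≡ evalTerms N e' ts
      automorphism-evalTerm (var y)    = eq y
      automorphism-evalTerm (app h ts) =
        trans (F.fun-comm h _) (cong (fun⟦_⟧ N h) (automorphism-evalTerms ts))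
      automorphism-evalTerms []       = refl
      automorphism-evalTerms (t ∷ ts) =
        cong₂ _∷_ (automorphism-evalTerm t) (automorphism-evalTerms ts)

    private
      extend : {e e' : V → Carrier N} → F.to ∘ e ≗ e' → ∀ {y z} → F.to y ≡ z →
               F.to ∘ maybe′ e y ≗ maybe′ e' z
      extend eq yz nothing  = yz
      extend eq yz (just u) = eq u

    automorphism-⊨ : {e e' : V → Carrier N} → F.to ∘ e ≗ e' →
                     (φ : Formula L V) → N ⊨ φ [ e ] ⇔ N ⊨ φ [ e' ]
    automorphism-⊨ eq fls = mk⇔ id id
    automorphism-⊨ eq (s ≈ t) = mk⇔
      (λ h → trans (sym (automorphism-evalTerm eq s))
                   (trans (cong F.to h) (automorphism-evalTerm eq t)))
      (λ h → to-injective (trans (automorphism-evalTerm eq s)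
                                 (trans h (sym (automorphism-evalTerm eq t)))))
    automorphism-⊨ eq (rel R ts) = mk⇔
      (λ h → subst (rel⟦_⟧ N R) (automorphism-evalTerms eq ts) (to (F.rel-comm R _) h))
      (λ h → from (F.rel-comm R _) (subst (rel⟦_⟧ N R) (sym (automorphism-evalTerms eq ts)) h))
    automorphism-⊨ eq (φ ⇒ ψ) = mk⇔
      (λ h → to (automorphism-⊨ eq ψ) ∘ h ∘ from (automorphism-⊨ eq φ))
      (λ h → from (automorphism-⊨ eq ψ) ∘ h ∘ to (automorphism-⊨ eq φ))
    automorphism-⊨ eq (all φ) = mk⇔
      (λ h z → to (automorphism-⊨ (extend eq (to-from z)) φ) (h (from′ z)))
      (λ h y → from (automorphism-⊨ (extend eq refl) φ) (h (F.to y)))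

  -- Finite supports of formulas.

  private
    amalgamate : ∀ {k l} (e₁ : Fin k → X) (e₂ : Fin l → X) →
                 Σ[ e ∈ (Fin (k + l) → X) ] e ∘ (_↑ˡ l) ≗ e₁ × e ∘ (k ↑ʳ_) ≗ e₂
    amalgamate {k = k} {l = l} e₁ e₂ =
      [ e₁ , e₂ ]′ ∘ splitAt k ,
      (λ i → cong [ e₁ , e₂ ]′ (splitAt-↑ˡ k i l)) ,
      (λ i → cong [ e₁ , e₂ ]′ (splitAt-↑ʳ k l i))

    map₂-≗ : ∀ {y} {Y : Set y} {f : W → X} {g : Y → W} {h : Y → X} → f ∘ g ≗ h →
             map₂ {A = V} f ∘ map₂ g ≗ map₂ h
    map₂-≗ eq (inj₁ _) = refl
    map₂-≗ eq (inj₂ y) = cong inj₂ (eq y)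

    underBinder : (W → V ⊎ X) → Maybe W → Maybe V ⊎ X
    underBinder u nothing  = inj₁ nothing
    underBinder u (just y) = map₁ just (u y)

    distrib : Maybe V ⊎ X → Maybe (V ⊎ X)
    distrib (inj₁ nothing)  = nothing
    distrib (inj₁ (just y)) = just (inj₁ y)
    distrib (inj₂ z)        = just (inj₂ z)

    distrib-underBinder : (u : W → V ⊎ X) → distrib ∘ underBinder u ≗ mapMaybe u
    distrib-underBinder u nothing = refl
    distrib-underBinder u (just y) with u y
    ... | inj₁ _ = refl
    ... | inj₂ _ = refl

  finite-support-terms : ∀ {n} (u : W → V ⊎ X) (ts : Vec (Term L W) n) →
    Σ[ k ∈ ℕ ] Σ[ e ∈ (Fin k → X) ] Σ[ ts₀ ∈ Vec (Term L (V ⊎ Fin k)) n ]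
      renameTerms (map₂ e) ts₀ ≡ renameTerms u ts
  finite-support-term : (u : W → V ⊎ X) (t : Term L W) →
    Σ[ k ∈ ℕ ] Σ[ e ∈ (Fin k → X) ] Σ[ t₀ ∈ Term L (V ⊎ Fin k) ]
      renameTerm (map₂ e) t₀ ≡ renameTerm u t
  finite-support-term u (var y) with u y
  ... | inj₁ z = 0 , (λ ()) , var (inj₁ z) , refl
  ... | inj₂ z = 1 , (λ _ → z) , var (inj₂ Fin.zero) , refl
  finite-support-term u (app h ts) with finite-support-terms u ts
  ... | k , e , ts₀ , eq = k , e , app h ts₀ , cong (app h) eq
  finite-support-terms u [] = 0 , (λ ()) , [] , refl
  finite-support-terms u (t ∷ ts)
    with finite-support-term u t | finite-support-terms u ts
  ... | k , e₁ , t₀ , eq₁ | l , e₂ , ts₀ , eq₂ with amalgamate e₁ e₂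
  ... | e , left , right = _ , e , renameTerm (map₂ (_↑ˡ l)) t₀ ∷ renameTerms (map₂ (k ↑ʳ_)) ts₀ ,
    cong₂ _∷_ (trans (renameTerm-≗ (map₂-≗ left) t₀) eq₁)
              (trans (renameTerms-≗ (map₂-≗ right) ts₀) eq₂)

  -- Stated for an arbitrary `u` so that the induction passes under `all`: the variables then lie in
  -- a `Maybe`, which is not a sum, and `underBinder` puts the bound one on the side of `V`, which
  -- needs no parameter.
  finite-support′ : (u : W → V ⊎ X) (φ : Formula L W) →
    Σ[ k ∈ ℕ ] Σ[ e ∈ (Fin k → X) ] Σ[ φ₀ ∈ Formula L (V ⊎ Fin k) ]
      rename (map₂ e) φ₀ ≡ rename u φ
  finite-support′ u fls = 0 , (λ ()) , fls , refl
  finite-support′ u (s ≈ t)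
    with finite-support-term u s | finite-support-term u t
  ... | k , e₁ , s₀ , eq₁ | l , e₂ , t₀ , eq₂ with amalgamate e₁ e₂
  ... | e , left , right = _ , e , renameTerm (map₂ (_↑ˡ l)) s₀ ≈ renameTerm (map₂ (k ↑ʳ_)) t₀ ,
    cong₂ _≈_ (trans (renameTerm-≗ (map₂-≗ left) s₀) eq₁)
              (trans (renameTerm-≗ (map₂-≗ right) t₀) eq₂)
  finite-support′ u (rel R ts) with finite-support-terms u ts
  ... | k , e , ts₀ , eq = k , e , rel R ts₀ , cong (rel R) eq
  finite-support′ u (φ ⇒ ψ)
    with finite-support′ u φ | finite-support′ u ψ
  ... | k , e₁ , φ₀ , eq₁ | l , e₂ , ψ₀ , eq₂ with amalgamate e₁ e₂
  ... | e , left , right = _ , e , rename (map₂ (_↑ˡ l)) φ₀ ⇒ rename (map₂ (k ↑ʳ_)) ψ₀ ,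
    cong₂ _⇒_ (trans (rename-≗ (map₂-≗ left) φ₀) eq₁)
              (trans (rename-≗ (map₂-≗ right) ψ₀) eq₂)
  finite-support′ u (all φ) with finite-support′ (underBinder u) φ
  ... | k , e , φ₀ , eq = k , e , all (rename distrib φ₀) ,
    cong all (trans (rename-≗ natural φ₀)
             (trans (sym (rename-∘ distrib (map₂ e) φ₀)) (trans (cong (rename distrib) eq)
                    (rename-≗ (distrib-underBinder u) φ))))
    where
    natural : mapMaybe (map₂ e) ∘ distrib ≗ distrib ∘ map₂ e
    natural (inj₁ nothing)  = refl
    natural (inj₁ (just y)) = refl
    natural (inj₂ z)        = refl

  finite-support : (φ : Formula L (V ⊎ X)) →
    Σ[ k ∈ ℕ ] Σ[ e ∈ (Fin k → X) ] Σ[ φ₀ ∈ Formula L (V ⊎ Fin k) ] rename (map₂ e) φ₀ ≡ φ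
  finite-support φ with finite-support′ id φ
  ... | k , e , φ₀ , eq = k , e , φ₀ , trans eq (rename-id φ)

-- Positions in sequences of length at most ω.

≤ᴸ-pred : ∀ m {l} → suc l ≤ᴸ m → l ≤ᴸ m
≤ᴸ-pred (fin n) = ≤-trans (n≤1+n _)
≤ᴸ-pred ω       = id

position : ∀ m l → suc l ≤ᴸ m → Position m
position (fin n) l l<n = fromℕ< l<n
position ω       l _   = l

index-position : ∀ m l l<m → index {m} (position m l l<m) ≡ l
index-position (fin n) l l<n = toℕ-fromℕ< l<n
index-position ω       l _   = refl

-- The positions l-1, …, 0.
positions : ∀ m l → l ≤ᴸ m → List (Position m)
positions m zero    _   = []
positions m (suc l) l<m = position m l l<m ∷ positions m l (≤ᴸ-pred m l<m)

length-map-positions : ∀ {b} {B : Set b} m (f : Position m → B) l l≤m → length (map f (positions m l l≤m)) ≡ l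
length-map-positions m f zero    _   = refl
length-map-positions m f (suc l) l<m = cong suc (length-map-positions m f l (≤ᴸ-pred m l<m))

-- Combs of bounded depth and their decomposition at the root.

shift : 2²^ω → 2²^ω
shift σ = σ ∘ suc

StartsWith : 2² → 2²^ω → Set
StartsWith t σ = σ 0 ≡ t

startsWith : ∀ {t τ C} → All (_Extends (t ∷ τ)) C → All (StartsWith t) C
startsWith = All.map (proj₁ ∘ ∷-injective)

extends-shift : ∀ {t τ C} → All (_Extends (t ∷ τ)) C → All (_Extends τ) (map shift C)
extends-shift = All.map⁺ ∘ All.map (proj₂ ∘ ∷-injective)

-- Every comb has a member, since the class starts from singletons.
head-unique : ∀ {◁ m t u C} → Comb ◁ m C → All (StartsWith t) C → All (StartsWith u) C → t ≡ u
head-unique (singleton σ) (refl ∷ []) (refl ∷ []) = refl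
head-unique (join {A} cA _ _ _) tC uC = head-unique cA (All.++⁻ˡ A tC) (All.++⁻ˡ A uC)

module _ (lo hi : Fin 2 → 2²) where

  -- NarrowlyBelow and NarrowlyLeft are definitionally instances of this.
  Narrowly : List 2²^ω → List 2²^ω → Set
  Narrowly A B = Σ[ τ ∈ List 2² ] Σ[ i ∈ Fin 2 ]
    All (_Extends (τ ++ [ lo i ])) A × All (_Extends (τ ++ [ hi i ])) B

  -- The level of the branching is bounded because a tree of depth `N` separates branches by their
  -- first `N` entries only.
  NarrowlyWithin : ℕ → List 2²^ω → List 2²^ω → Set
  NarrowlyWithin N A B = Σ[ (τ , _) ∈ Narrowly A B ] length τ < N

  -- A comb is built by finitely many joins; `N₀` exceeds the branching level of each of them.
  comb-within : ∀ {m C} → Comb Narrowly m C → ∃[ N₀ ] ∀ {N} → N₀ ≤ N → Comb (NarrowlyWithin N) m C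
  comb-within (singleton σ) = 0 , λ _ → singleton σ
  comb-within (join cA cB A≤m A◁B@(τ , _)) with comb-within cA | comb-within cB
  ... | NA , wA | NB , wB = suc (length τ) ⊔ₙ (NA ⊔ₙ NB) , λ N₀≤N →
    let NA⊔NB≤N = ≤-trans (m≤n⊔m (suc (length τ)) (NA ⊔ₙ NB)) N₀≤N in
    join (wA (≤-trans (m≤m⊔n NA NB) NA⊔NB≤N)) (wB (≤-trans (m≤n⊔m NA NB) NA⊔NB≤N)) A≤m
         (A◁B , ≤-trans (m≤m⊔n (suc (length τ)) (NA ⊔ₙ NB)) N₀≤N)

  module _ (lo≢hi : ∀ i → lo i ≢ hi i) where

    -- Since all members share their first entry, no join branches at the root: its halves would
    -- start with the different entries `lo i` and `hi i`. Every other branching level drops by one.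
    comb-shift : ∀ {N m t C} → Comb (NarrowlyWithin (suc N)) m C → All (StartsWith t) C →
                 Comb (NarrowlyWithin N) m (map shift C)
    comb-shift (singleton σ) _ = singleton (shift σ)
    comb-shift (join {A} cA cB _ (([] , i , extA , extB) , _)) tC = ⊥-elim (lo≢hi i
      (trans (head-unique cA (startsWith extA) (All.++⁻ˡ A tC))
             (head-unique cB (All.++⁻ʳ A tC) (startsWith extB))))
    comb-shift {m = m} (join {A} {B} cA cB A≤m ((_ ∷ τ , i , extA , extB) , s≤s τ<N)) tC
      rewrite map-++ shift A B =
      join (comb-shift cA (All.++⁻ˡ A tC)) (comb-shift cB (All.++⁻ʳ A tC))
           (subst (_≤ᴸ m) (sym (length-map shift A)) A≤m)
           ((τ , i , extends-shift extA , extends-shift extB) , τ<N)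

    -- The cases for the induction on depth: the comb stays in one of the four subtrees at the root,
    -- or its outermost join is between two of them.
    data Decomposition (N : ℕ) (m : Length) : List 2²^ω → Set where
      inside   : ∀ {C} t → All (StartsWith t) C → Comb (NarrowlyWithin N) m (map shift C) →
                 Decomposition N m C
      straddle : ∀ {A B} i → All (StartsWith (lo i)) A → All (StartsWith (hi i)) B → length A ≤ᴸ m →
                 Comb (NarrowlyWithin N) m (map shift A) → Comb (NarrowlyWithin N) m (map shift B) →
                 Decomposition N m (A ++ B)

    decompose : ∀ {N m C} → Comb (NarrowlyWithin (suc N)) m C → Decomposition N m C
    decompose (singleton σ) = inside (σ 0) (refl ∷ []) (singleton (shift σ))
    decompose (join cA cB A≤m (([] , i , extA , extB) , _)) =
      straddle i (startsWith extA) (startsWith extB) A≤m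
        (comb-shift cA (startsWith extA)) (comb-shift cB (startsWith extB))
    decompose c@(join cA cB A≤m ((t ∷ τ , i , extA , extB) , _)) = inside t tC (comb-shift c tC)
      where
      tC = All.++⁺ (startsWith extA) (startsWith extB)

  comb-depth-0 : ∀ {m C} → Comb (NarrowlyWithin 0) m C → ∃[ σ ] C ≡ [ σ ]
  comb-depth-0 (singleton σ) = σ , refl
  comb-depth-0 (join _ _ _ (_ , ()))

-- Numbering the members of a list.

-- Members of C are numbered from the end of the list, like `positions`.
data At {x} {X : Set x} : List X → X → ℕ → Set x where
  here  : ∀ {x xs} → At (x ∷ xs) x (length xs)
  there : ∀ {x y xs n} → At xs y n → At (x ∷ xs) y n

module _ {x} {X : Set x} where

  at : ∀ {y : X} {xs} → y ∈ xs → ∃[ n ] At xs y n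
  at (here refl) = _ , here
  at (there y∈xs) = let (n , y↦n) = at y∈xs in n , there y↦n

  at-< : ∀ {y : X} {xs n} → At xs y n → n < length xs
  at-< here       = n<1+n _
  at-< (there y↦n) = m<n⇒m<1+n (at-< y↦n)

  at-injective : ∀ {y z : X} {xs n} → At xs y n → At xs z n → y ≡ z
  at-injective here        here        = refl
  at-injective here        (there z↦n) = ⊥-elim (<⇒≢ (at-< z↦n) refl)
  at-injective (there y↦n) here        = ⊥-elim (<⇒≢ (at-< y↦n) refl)
  at-injective (there y↦n) (there z↦n) = at-injective y↦n z↦n

  at-all : ∀ {xs ys : List X} → All (_∈ xs) ys → ∃[ ns ] Pointwise (At xs) ys ns
  at-all []            = [] , []
  at-all (y∈xs ∷ ys⊆xs) = let (_ , y↦n) = at y∈xs ; (_ , ys↦ns) = at-all ys⊆xs in _ , y↦n ∷ ys↦ns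

  -- A number determines its member, so distinct members get distinct numbers. This matters because
  -- k-inconsistency counts indices.
  at-unique : ∀ {xs ys : List X} {ns} → Unique ys → Pointwise (At xs) ys ns → Unique ns
  at-unique []         []           = []
  at-unique (y∉ ∷ uys) (y↦n ∷ ys↦ns) = distinct y∉ ys↦ns ∷ at-unique uys ys↦ns
    where
    distinct : ∀ {zs ks} → All (_ ≢_) zs → Pointwise (At _) zs ks → All (_ ≢_) ks
    distinct []         []            = []
    distinct (y≢z ∷ y≢) (z↦k ∷ zs↦ks) =
      (λ { refl → y≢z (at-injective y↦n z↦k) }) ∷ distinct y≢ zs↦ks

below above leftOf rightOf : Fin 2 → 2²
below i   = i , 0F
above i   = i , 1F
leftOf j  = 0F , j
rightOf j = 1F , j

-- Types and invariant types over `a` in the monster model.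

module Monster (em : ∀ {e : Level} → ExcludedMiddle e)
         {ℓ : Level} {L : Language ℓ} (M : Structure L) (monster : IsMonster M) where

  open IsMonster monster

  private
    ∣M∣ : Set (lsuc ℓ)
    ∣M∣ = Carrier M

    dne : ∀ {p} {P : Set p} → ¬ ¬ P → P
    dne {P = P} ¬¬p with em {P = P}
    ... | yes p = p
    ... | no ¬p = ⊥-elim (¬¬p ¬p)

    refute : ∀ {b} {B : Set b} → Poly.⊥ {lsuc ℓ} → B
    refute ()

  _~_ : ∀ {x} {X : Set x} → (X → ∣M∣) → (X → ∣M∣) → Set (lsuc ℓ ⊔ x)
  e ~ e′ = ∀ φ → M ⊨ φ [ e ] ⇔ M ⊨ φ [ e′ ]

  -- Applying the inclusion to negations reverses it, types of tuples being complete.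
  ~-from-⊆ : ∀ {x} {X : Set x} {e e′ : X → ∣M∣} →
             (∀ φ → M ⊨ φ [ e ] → M ⊨ φ [ e′ ]) → e ~ e′
  ~-from-⊆ h φ = mk⇔ (h φ) λ φe′ → dne λ ¬φe → refute (h (not φ) (λ φe → ⊥-elim (¬φe φe)) φe′)

  ~-reindex : ∀ {x y} {X : Set x} {Y : Set y} {e e′ : X → ∣M∣} {d d′ : Y → ∣M∣} → e ~ e′ →
              (k : Y → X) → e ∘ k ≗ d → e′ ∘ k ≗ d′ → d ~ d′
  ~-reindex e~e′ k eq eq′ φ = mk⇔
    (to (⊨-rename M eq′ φ) ∘ to (e~e′ (rename k φ)) ∘ from (⊨-rename M eq φ))
    (to (⊨-rename M eq φ) ∘ from (e~e′ (rename k φ)) ∘ from (⊨-rename M eq′ φ))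

  module Over {I : Set ℓ} (a : I → ∣M∣) where

    infix 4 _≣_

    -- Equality of types over `a`. The parameters belong to both tuples, so that `homogeneous`
    -- yields an automorphism fixing `a` and carrying `d` to `d′`.
    _≣_ : {J : Set ℓ} → (J → ∣M∣) → (J → ∣M∣) → Set (lsuc ℓ)
    d ≣ d′ = [ a , d ]′ ~ [ a , d′ ]′

    private variable
      J K Y Z Z′ V : Set ℓ

    private
      over : {d : K → ∣M∣} {d′ : J → ∣M∣} {k : J → K} → d ∘ k ≗ d′ →
             [ a , d ]′ ∘ map₂ k ≗ [ a , d′ ]′
      over eq (inj₁ _) = refl
      over eq (inj₂ j) = eq j

    ≣-reindex : {e e′ : K → ∣M∣} {d d′ : J → ∣M∣} → e ≣ e′ →
                (k : J → K) → e ∘ k ≗ d → e′ ∘ k ≗ d′ → d ≣ d′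
    ≣-reindex e≣e′ k eq eq′ = ~-reindex e≣e′ (map₂ k) (over eq) (over eq′)

    ≣-empty : {d d′ : J → ∣M∣} → (J → Poly.⊥ {ℓ}) → d ≣ d′
    ≣-empty {J = J} {d} {d′} empty = ~-reindex {e = a} {e′ = a} (λ φ → mk⇔ id id) k eq eq′
      where
      k : I ⊎ J → I
      k (inj₁ i) = i
      k (inj₂ j) with () ← empty j
      eq : a ∘ k ≗ [ a , d ]′
      eq (inj₁ i) = refl
      eq (inj₂ j) with () ← empty j
      eq′ : a ∘ k ≗ [ a , d′ ]′
      eq′ (inj₁ i) = refl
      eq′ (inj₂ j) with () ← empty j

    ≣-refl : {d : J → ∣M∣} → d ≣ d
    ≣-refl φ = mk⇔ id id

    ≣-sym : {d e : J → ∣M∣} → d ≣ e → e ≣ d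
    ≣-sym d≣e φ = mk⇔ (from (d≣e φ)) (to (d≣e φ))

    ≣-trans : {d e f : J → ∣M∣} → d ≣ e → e ≣ f → d ≣ f
    ≣-trans d≣e e≣f φ = mk⇔ (to (e≣f φ) ∘ to (d≣e φ)) (from (d≣e φ) ∘ from (e≣f φ))

    ≣⇒tp⊆ : {d d′ : J → ∣M∣} → d ≣ d′ → tp M d a ⊆ tp M d′ a
    ≣⇒tp⊆ {J = J} {d} {d′} d≣d′ {φ} = to (~-reindex {e = [ a , d ]′} {e′ = [ a , d′ ]′} d≣d′ swap eq eq′ φ)
      where
      swap : J ⊎ I → I ⊎ J
      swap = [ inj₂ , inj₁ ]′
      eq : [ a , d ]′ ∘ swap ≗ [ d , a ]′
      eq (inj₁ _) = refl
      eq (inj₂ _) = refl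
      eq′ : [ a , d′ ]′ ∘ swap ≗ [ d′ , a ]′
      eq′ (inj₁ _) = refl
      eq′ (inj₂ _) = refl

    tp⊆⇒≣ : {d d′ : J → ∣M∣} → tp M d a ⊆ tp M d′ a → d ≣ d′
    tp⊆⇒≣ {J = J} {d} {d′} h = ~-reindex (~-from-⊆ λ φ → h {φ}) swap eq eq′
      where
      swap : I ⊎ J → J ⊎ I
      swap = [ inj₂ , inj₁ ]′
      eq : [ d , a ]′ ∘ swap ≗ [ a , d ]′
      eq (inj₁ _) = refl
      eq (inj₂ _) = refl
      eq′ : [ d′ , a ]′ ∘ swap ≗ [ a , d′ ]′
      eq′ (inj₁ _) = refl
      eq′ (inj₂ _) = refl

    Realizes : InvariantType M a V → (V → ∣M∣) → (J → ∣M∣) → Set (lsuc ℓ)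
    Realizes P x d = let ad = [ a , d ]′ in _↾_ M (pred P) ad ⊆ tp M x ad

    module _ (P : InvariantType M a V) where

      -- Homogeneity gives an automorphism over `a` carrying `d` to `d′`; it fixes `P`, so it moves
      -- one restriction into the other.
      invariance : {d d′ : J → ∣M∣} → d ≣ d′ →
                   _↾_ M (pred P) [ a , d ]′ ⊆ _↾_ M (pred P) [ a , d′ ]′
      invariance {J} {d} {d′} d≣d′ {φ} Pφ with homogeneous [ a , d ]′ [ a , d′ ]′ d≣d′
      ... | F , F-maps = subst (pred P) (rename-≗ eq φ)
                           (to (invariant P F (F-maps ∘ inj₁) _) Pφ)
        where
        eq : map₂ (Automorphism.to F) ∘ map₂ [ a , d ]′ ≗ map₂ [ a , d′ ]′
        eq (inj₁ _) = refl
        eq (inj₂ j) = cong inj₂ (F-maps j)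

      -- The restriction inherits finite satisfiability from `P`, and saturation applies because `a`
      -- and `d` are small.
      realization : (d : J → ∣M∣) → Σ[ x ∈ (V → ∣M∣) ] Realizes P x d
      realization d = saturated [ a , d ]′ (_↾_ M (pred P) [ a , d ]′) λ φs Pφs →
        let (x , xs) = IsType.finSat (isType P) (map (rename (map₂ [ a , d ]′)) φs) (All.map⁺ Pφs)
        in x , All.map (λ {φ} → to (⊨-rename M (λ { (inj₁ _) → refl ; (inj₂ _) → refl }) φ))
                       (All.map⁻ xs)

      module _ {x : V → ∣M∣} {d : J → ∣M∣} (x⊨P : Realizes P x d) where

        realizes-⊇ : tp M x [ a , d ]′ ⊆ _↾_ M (pred P) [ a , d ]′
        realizes-⊇ {φ} φx with IsType.complete (isType P) (rename (map₂ [ a , d ]′) φ)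
        ... | inj₁ Pφ  = Pφ
        ... | inj₂ P¬φ = refute (x⊨P {not φ} P¬φ φx)

        realizes-reindex : {d′ : K → ∣M∣} (k : K → J) → d ∘ k ≗ d′ → Realizes P x d′
        realizes-reindex k eq {φ} Pφ =
          to (⊨-rename M {f = map₂ (map₂ k)} eqM φ) (x⊨P (subst (pred P) (sym (rename-≗ {g = map₂ (map₂ k)} eqP φ)) Pφ))
          where
          eqP : map₂ {A = V} [ a , d ]′ ∘ map₂ (map₂ k) ≗ map₂ [ a , _ ]′
          eqP (inj₁ _) = refl
          eqP (inj₂ j) = cong inj₂ (over eq j)
          eqM : [ x , [ a , d ]′ ]′ ∘ map₂ (map₂ k) ≗ [ x , [ a , _ ]′ ]′
          eqM (inj₁ _) = refl
          eqM (inj₂ j) = over eq j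

        private
          assoc : ∀ {i} {I : Set i} → V ⊎ (I ⊎ J) → I ⊎ (V ⊎ J)
          assoc (inj₁ y)        = inj₂ (inj₁ y)
          assoc (inj₂ (inj₁ i)) = inj₁ i
          assoc (inj₂ (inj₂ j)) = inj₂ (inj₂ j)

          assoc⁻ : ∀ {i} {I : Set i} → I ⊎ (V ⊎ J) → V ⊎ (I ⊎ J)
          assoc⁻ (inj₁ i)        = inj₂ (inj₁ i)
          assoc⁻ (inj₂ (inj₁ y)) = inj₁ y
          assoc⁻ (inj₂ (inj₂ j)) = inj₂ (inj₂ j)

          eq : ∀ {x d} → [ a , [ x , d ]′ ]′ ∘ assoc ≗ [ x , [ a , d ]′ ]′
          eq (inj₁ y)        = refl
          eq (inj₂ (inj₁ i)) = refl
          eq (inj₂ (inj₂ j)) = refl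

          eq⁻ : ∀ {x d} → [ x , [ a , d ]′ ]′ ∘ assoc⁻ ≗ [ a , [ x , d ]′ ]′
          eq⁻ (inj₁ i)        = refl
          eq⁻ (inj₂ (inj₁ y)) = refl
          eq⁻ (inj₂ (inj₂ j)) = refl

        -- The type of `x` over `d` can be read off from `P`, and `invariance` moves it to `d′`.
        realizes-unique : {x′ : V → ∣M∣} {d′ : J → ∣M∣} → Realizes P x′ d′ → d ≣ d′ →
                          [ x , d ]′ ≣ [ x′ , d′ ]′
        realizes-unique x′⊨P d≣d′ = ~-reindex
          (~-from-⊆ λ φ φx → x′⊨P (invariance d≣d′ {φ} (realizes-⊇ φx))) assoc⁻ eq⁻ eq⁻

        -- The equivalence of `d` and `d′` moves the restriction of `P` back to `d`, where `x`
        -- realizes it; the equivalence of the full tuples then moves truth forward.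
        realizes-transfer : {x′ : V → ∣M∣} {d′ : J → ∣M∣} → [ x , d ]′ ≣ [ x′ , d′ ]′ → Realizes P x′ d′
        realizes-transfer same {φ} Pφ =
          to (~-reindex same assoc eq eq φ)
             (x⊨P (invariance (≣-sym (≣-reindex same inj₂ (λ _ → refl) (λ _ → refl))) {φ} Pφ))

    InvIndep-reindex : {c : J → ∣M∣} {b : K → ∣M∣} {b′ : Y → ∣M∣} → InvIndep M c a b →
                       (k : Y → K) → b ∘ k ≗ b′ → InvIndep M c a b′
    InvIndep-reindex {c = c} {b} {b′} (P , ⊆P) k eq = P , λ {φ} φc →
      subst (pred P) (rename-≗ {g = map₂ (map₂ k)} eqP φ) (⊆P (from (⊨-rename M {f = map₂ (map₂ k)} eqM φ) φc))
      where
      eqP : map₂ [ a , b ]′ ∘ map₂ (map₂ k) ≗ map₂ [ a , b′ ]′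
      eqP (inj₁ _) = refl
      eqP (inj₂ j) = cong inj₂ (over eq j)
      eqM : [ c , [ a , b ]′ ]′ ∘ map₂ (map₂ k) ≗ [ c , [ a , b′ ]′ ]′
      eqM (inj₁ _) = refl
      eqM (inj₂ j) = over eq j

    realizes⇒InvIndep : (P : InvariantType M a V) {x : V → ∣M∣} {d : J → ∣M∣} →
                        Realizes P x d → InvIndep M x a d
    realizes⇒InvIndep P x⊨P = P , realizes-⊇ P x⊨P

    module _ (P : InvariantType M a V) {x : V → ∣M∣} where

      private
        base : V ⊎ I → V ⊎ (I ⊎ J)
        base = map₂ inj₁

      realizes⇒⊆tp : {d : J → ∣M∣} → Realizes P x d → _↾_ M (pred P) a ⊆ tp M x a
      realizes⇒⊆tp {d = d} x⊨P {φ} Pφ = to (⊨-rename M {f = base} eqM φ)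
        (x⊨P (subst (pred P) (sym (rename-≗ {g = base} eqP φ)) Pφ))
        where
        eqP : map₂ [ a , d ]′ ∘ base ≗ map₂ a
        eqP (inj₁ _) = refl
        eqP (inj₂ _) = refl
        eqM : [ x , [ a , d ]′ ]′ ∘ base ≗ [ x , a ]′
        eqM (inj₁ _) = refl
        eqM (inj₂ _) = refl

      InvIndep⇒tp⊆ : {d : J → ∣M∣} → tp M x [ a , d ]′ ⊆ _↾_ M (pred P) [ a , d ]′ →
                     tp M x a ⊆ _↾_ M (pred P) a
      InvIndep⇒tp⊆ {d = d} ⊆P {φ} φx = subst (pred P) (rename-≗ {g = base} eqP φ)
        (⊆P (from (⊨-rename M {f = base} eqM φ) φx))
        where
        eqP : map₂ [ a , d ]′ ∘ base ≗ map₂ a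
        eqP (inj₁ _) = refl
        eqP (inj₂ _) = refl
        eqM : [ x , [ a , d ]′ ]′ ∘ base ≗ [ x , a ]′
        eqM (inj₁ _) = refl
        eqM (inj₂ _) = refl

      -- Over an empty base only the type over `a` matters; this serves the first member of a
      -- sequence.
      tp⊆⇒InvIndep : tp M x a ⊆ _↾_ M (pred P) a → {d : J → ∣M∣} → (J → Poly.⊥ {ℓ}) → InvIndep M x a d
      tp⊆⇒InvIndep {J} ⊆P {d} empty = P , λ {φ} φx →
        subst (pred P) (rename-≗ {g = k} eqP φ) (⊆P (from (⊨-rename M {f = k} eqM φ) φx))
        where
        k : V ⊎ (I ⊎ J) → V ⊎ I
        k (inj₁ y)        = inj₁ y
        k (inj₂ (inj₁ i)) = inj₂ i
        k (inj₂ (inj₂ j)) with () ← empty j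
        eqP : map₂ a ∘ k ≗ map₂ [ a , d ]′
        eqP (inj₁ y)        = refl
        eqP (inj₂ (inj₁ i)) = refl
        eqP (inj₂ (inj₂ j)) with () ← empty j
        eqM : [ x , a ]′ ∘ k ≗ [ x , [ a , d ]′ ]′
        eqM (inj₁ y)        = refl
        eqM (inj₂ (inj₁ i)) = refl
        eqM (inj₂ (inj₂ j)) with () ← empty j

    -- Partial elementary correspondences, and Morley sequences inside one tuple.

    Graph : (Z → Z′ → Set ℓ) → Set ℓ
    Graph {Z} {Z′} R = Σ[ ζ ∈ Z ] Σ[ ζ′ ∈ Z′ ] R ζ ζ′

    π₁ : {R : Z → Z′ → Set ℓ} → Graph R → Z
    π₁ = proj₁

    π₂ : {R : Z → Z′ → Set ℓ} → Graph R → Z′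
    π₂ = proj₁ ∘ proj₂

    -- `R` is a partial elementary map over `a`, possibly multivalued: enumerating its pairs gives
    -- two tuples, which are compared by `≣`.
    Elementary : (z : Z → ∣M∣) (z′ : Z′ → ∣M∣) → (Z → Z′ → Set ℓ) → Set (lsuc ℓ)
    Elementary z z′ R = z ∘ π₁ {R = R} ≣ z′ ∘ π₂ {R = R}

    ∅ : Pred Z ℓ
    ∅ _ = Poly.⊥

    Range : (Y → Z) → Pred Z ℓ
    Range k ζ = ∃[ y ] ζ ≡ k y

    module _ {V : Set ℓ} where

      Cover : List (V → Z) → Pred Z ℓ
      Cover hs ζ = Any (λ h → Range h ζ) hs

      data Corr {Z Z′ : Set ℓ} : List (V → Z) → List (V → Z′) → Z → Z′ → Set ℓ where
        here  : ∀ {h h′ hs hs′} y → Corr (h ∷ hs) (h′ ∷ hs′) (h y) (h′ y)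
        there : ∀ {h h′ hs hs′ ζ ζ′} → Corr hs hs′ ζ ζ′ → Corr (h ∷ hs) (h′ ∷ hs′) ζ ζ′

      corr-cover₁ : {hs : List (V → Z)} {hs′ : List (V → Z′)} → ∀ {ζ ζ′} → Corr hs hs′ ζ ζ′ → Cover hs ζ
      corr-cover₁ (here y)  = here (y , refl)
      corr-cover₁ (there c) = there (corr-cover₁ c)

      corr-cover₂ : {hs : List (V → Z)} {hs′ : List (V → Z′)} → ∀ {ζ ζ′} → Corr hs hs′ ζ ζ′ → Cover hs′ ζ′
      corr-cover₂ (here y)  = here (y , refl)
      corr-cover₂ (there c) = there (corr-cover₂ c)

      module _ (p : InvariantType M a V) where

        -- Bases are predicates on the slots of one ambient tuple `z`, so that changing the base is
        -- an inclusion of predicates.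
        RealizesOver : (z : Z → ∣M∣) → (V → Z) → Pred Z ℓ → Set (lsuc ℓ)
        RealizesOver {Z} z h S = Realizes p (z ∘ h) (z ∘ proj₁ {A = Z} {B = S})

        realizesOver-⊆ : {z : Z → ∣M∣} {h : V → Z} {S S′ : Pred Z ℓ} → S′ ⊆ S →
                         RealizesOver z h S → RealizesOver z h S′
        realizesOver-⊆ S′⊆S ⊨p = realizes-reindex p ⊨p (λ (ζ , s) → ζ , S′⊆S s) (λ _ → refl)

        -- The latest member of the sequence stands first in the list.
        data Morley {Z : Set ℓ} (z : Z → ∣M∣) (S : Pred Z ℓ) : List (V → Z) → Set (lsuc ℓ) where
          []  : Morley z S []
          _∷_ : ∀ {h hs} → RealizesOver z h (S ∪ Cover hs) → Morley z S hs → Morley z S (h ∷ hs)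

        -- Lists run backwards in time, so `A` continues the sequence `B`; each member of `A`
        -- already realizes `p` over all of `B`.
        morley-++ : {z : Z → ∣M∣} {S : Pred Z ℓ} {A B : List (V → Z)} → Cover B ⊆ S →
                    Morley z S A → Morley z ∅ B → Morley z ∅ (A ++ B)
        morley-++ B⊆S [] mB = mB
        morley-++ {S = S} {A = _ ∷ A} {B} B⊆S (⊨p ∷ mA) mB = realizesOver-⊆ cover ⊨p ∷ morley-++ B⊆S mA mB
          where
          cover : (∅ ∪ Cover (A ++ B)) ⊆ (S ∪ Cover A)
          cover (inj₂ c) with Any.++⁻ A c
          ... | inj₁ cA = inj₂ cA
          ... | inj₂ cB = inj₁ (B⊆S cB)

        -- Induction from the earliest member by `realizes-unique`. The bases are forgotten on the
        -- way, so sequences over different bases can be compared.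
        morley-unique : {z : Z → ∣M∣} {z′ : Z′ → ∣M∣} {S : Pred Z ℓ} {S′ : Pred Z′ ℓ} →
                        ∀ {hs hs′} → Morley z S hs → Morley z′ S′ hs′ → Elementary z z′ (Corr hs hs′)
        morley-unique [] _ = ≣-empty λ ()
        morley-unique (_ ∷ _) [] = ≣-empty λ ()
        morley-unique {z = z} {z′} {hs = h ∷ hs} {h′ ∷ hs′} (⊨p ∷ m) (⊨p′ ∷ m′) =
          ≣-reindex
            (realizes-unique p
              (realizes-reindex p ⊨p (λ (ζ , _ , c) → ζ , inj₂ (corr-cover₁ c)) (λ _ → refl))
              (realizes-reindex p ⊨p′ (λ (_ , ζ′ , c) → ζ′ , inj₂ (corr-cover₂ c)) (λ _ → refl))
              (morley-unique m m′))
            split eq eq′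
          where
          split : Graph (Corr (h ∷ hs) (h′ ∷ hs′)) → V ⊎ Graph (Corr hs hs′)
          split (_ , _ , here y)  = inj₁ y
          split (_ , _ , there c) = inj₂ (_ , _ , c)
          eq : [ z ∘ h , z ∘ π₁ ]′ ∘ split ≗ z ∘ π₁
          eq (_ , _ , here y)  = refl
          eq (_ , _ , there c) = refl
          eq′ : [ z′ ∘ h′ , z′ ∘ π₂ ]′ ∘ split ≗ z′ ∘ π₂
          eq′ (_ , _ , here y)  = refl
          eq′ (_ , _ , there c) = refl

        module _ {z : Z → ∣M∣} {z′ : Z′ → ∣M∣} {R : Z → Z′ → Set ℓ} (elem : Elementary z z′ R) where

          private
            Related : (V → Z) → (V → Z′) → Set ℓ
            Related h h′ = ∀ y → R (h y) (h′ y)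

            preimage : ∀ {hs hs′} → Pointwise Related hs hs′ →
                       ∀ {ζ′} → Cover hs′ ζ′ → ∃[ ζ ] Cover hs ζ × R ζ ζ′
            preimage (r ∷ rs) (here (y , refl)) = _ , here (y , refl) , r y
            preimage (r ∷ rs) (there c) with preimage rs c
            ... | ζ , c′ , rζ = ζ , there c′ , rζ

          -- By `realizes-transfer`, being Morley depends only on types over `a`. The argument `pre`
          -- matches every slot of the new base with one of the old base.
          morley-transfer : {S : Pred Z ℓ} {S′ : Pred Z′ ℓ} → (∀ {ζ′} → S′ ζ′ → ∃[ ζ ] S ζ × R ζ ζ′) →
                            ∀ {hs hs′} → Pointwise Related hs hs′ → Morley z S hs → Morley z′ S′ hs′
          morley-transfer pre [] [] = []
          morley-transfer {S} {S′} pre {h ∷ hs} {h′ ∷ hs′} (r ∷ rs) (⊨p ∷ m) =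
            realizes-transfer p (realizes-reindex p ⊨p k (λ _ → refl))
              (≣-reindex elem toGraph eq eq′)
            ∷ morley-transfer pre rs m
            where
            pull : ∀ {ζ′} → (S′ ∪ Cover hs′) ζ′ → ∃[ ζ ] (S ∪ Cover hs) ζ × R ζ ζ′
            pull (inj₁ s) with pre s
            ... | ζ , s′ , rζ = ζ , inj₁ s′ , rζ
            pull (inj₂ c) with preimage rs c
            ... | ζ , c′ , rζ = ζ , inj₂ c′ , rζ
            k : Σ[ ζ′ ∈ Z′ ] (S′ ∪ Cover hs′) ζ′ → Σ[ ζ ∈ Z ] (S ∪ Cover hs) ζ
            k (_ , s) = let (ζ , s′ , _) = pull s in ζ , s′
            toGraph : V ⊎ (Σ[ ζ′ ∈ Z′ ] (S′ ∪ Cover hs′) ζ′) → Graph R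
            toGraph (inj₁ y)       = _ , _ , r y
            toGraph (inj₂ (_ , s)) = let (_ , _ , rζ) = pull s in _ , _ , rζ
            eq : z ∘ π₁ ∘ toGraph ≗ [ z ∘ h , z ∘ proj₁ ∘ k ]′
            eq (inj₁ _) = refl
            eq (inj₂ _) = refl
            eq′ : z′ ∘ π₂ ∘ toGraph ≗ [ z′ ∘ h′ , z′ ∘ proj₁ ]′
            eq′ (inj₁ _) = refl
            eq′ (inj₂ _) = refl

        morley-image : {z : Z → ∣M∣} {z′ : Z′ → ∣M∣} (k : Z → Z′) → z ≣ z′ ∘ k →
                       ∀ {hs} → Morley z ∅ hs → Morley z′ ∅ (map (k ∘_) hs)
        morley-image {z = z} {z′} k z≣z′k {hs} =
          morley-transfer {R = λ ζ ζ′ → ζ′ ≡ k ζ}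
            (≣-reindex z≣z′k π₁ (λ _ → refl) (λ (_ , _ , eq) → cong z′ (sym eq)))
            (λ ()) (pointwise hs)
          where
          pointwise : ∀ hs → Pointwise (λ h h′ → ∀ y → h′ y ≡ k (h y)) hs (map (k ∘_) hs)
          pointwise []       = []
          pointwise (h ∷ hs) = (λ _ → refl) ∷ pointwise hs

    -- Morley sequences indexed by positions.

    module _ (p : InvariantType M a V) where

      -- Passes from families whose predecessors are described by `Before` to the list form, taking
      -- the first `l` members.
      morley-positions : ∀ {m} {z : Z → ∣M∣} {S : Pred Z ℓ} (g : Position m → V → Z) →
        (∀ i → RealizesOver p z (g i) (S ∪ λ ζ → Σ[ (j , _) ∈ Before {m} i ] Range (g j) ζ)) →
        ∀ l l≤m → Morley p z S (map g (positions m l l≤m))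
      morley-positions g ⊨p zero    _   = []
      morley-positions {m = m} {S = S} g ⊨p (suc l) l<m =
        realizesOver-⊆ p earlier (⊨p (position m l l<m)) ∷ morley-positions g ⊨p l (≤ᴸ-pred m l<m)
        where
        bounded : ∀ l l≤m {ζ} → Cover (map g (positions m l l≤m)) ζ →
                  Σ[ j ∈ Position m ] index {m} j < l × Range (g j) ζ
        bounded (suc l) l<m (here r) =
          position m l l<m , s≤s (≤-reflexive (index-position m l l<m)) , r
        bounded (suc l) l<m (there c) with bounded l _ c
        ... | j , j<l , r = j , m<n⇒m<1+n j<l , r
        earlier : (S ∪ Cover (map g (positions m l _))) ⊆
                  (S ∪ λ ζ → Σ[ (j , _) ∈ Before {m} (position m l l<m) ] Range (g j) ζ)
        earlier (inj₁ s) = inj₁ s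
        earlier (inj₂ c) with bounded l _ c
        ... | j , j<l , r = inj₂ ((j , subst (_ <_) (sym (index-position m l l<m)) j<l) , r)

      sequence-morley : {b : ℕ → V → ∣M∣} → MorleySequence M p b → ∀ l →
                        Morley p (uncurry b) ∅ (map _,_ (positions ω l tt))
      sequence-morley {b} morley l = morley-positions {m = ω} {S = ∅} _,_
        (λ i → realizes-reindex p (morley i)
          (λ { (_ , inj₂ (j , y , _)) → j , y }) (λ { (_ , inj₂ (j , y , refl)) → refl }))
        l tt

      -- The recursion is on finite approximations with junk values at i ≥ n.
      private
        approx : ℕ → ℕ → V → ∣M∣
        new    : ℕ → V → ∣M∣
        approx zero    i = λ _ → nonEmpty M
        approx (suc n) i with i ≟ n
        ... | yes _ = new n
        ... | no  _ = approx n i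
        new n = proj₁ (realization p {J = Before {ω} n × V} λ ((j , _) , y) → approx n j y)

        approx≡new : ∀ n {i} → i < n → approx n i ≡ new i
        approx≡new (suc n) {i} i<1+n with i ≟ n
        ... | yes refl = refl
        ... | no  i≢n  = approx≡new n (≤∧≢⇒< (≤-pred i<1+n) i≢n)

      morleySequence : Σ[ b ∈ (ℕ → V → ∣M∣) ] MorleySequence M p b
      morleySequence = new , λ n → realizes-reindex p
        (proj₂ (realization p λ ((j , _) , y) → approx n j y)) id
        (λ ((j , j<n) , y) → cong (λ f → f y) (approx≡new n j<n))

    -- Realizations of powers of an invariant type.

    module _ {V Z : Set ℓ} {p : InvariantType M a V} {m : Length} {r : InvariantType M a (Position m × V)}
             (power : IsPower M p m r)
             {z : Z → ∣M∣} {c : Position m × V → ∣M∣} (c⊨r : Realizes r c z) where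

      open ElementaryExtension (proj₁ power)

      private
        b : Position m → V → Carrier big
        b = proj₁ (proj₂ power)

        morley : MorleySequenceOverM M p (proj₁ power) m b
        morley = proj₁ (proj₂ (proj₂ power))

        r≐ : pred r ≐ tp big (λ (i , y) → b i y) ι
        r≐ = proj₂ (proj₂ (proj₂ power))

        b′ : Position m × V → Carrier big
        b′ (i , y) = b i y

        -- `c` realizes `r` over `a` and `z`, and `r` is the type of `b′` over the monster model; so
        -- `c` inside it and `b′` in `big` satisfy the same formulas over `a` and `z`.
        bridge : ∀ {x} {X : Set x} {e : X → ∣M∣} {e′ : X → Carrier big} (u : X → (Position m × V) ⊎ (I ⊎ Z)) →
                 [ c , [ a , z ]′ ]′ ∘ u ≗ e → [ b′ , ι ∘ [ a , z ]′ ]′ ∘ u ≗ e′ →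
                 ∀ ψ → M ⊨ ψ [ e ] ⇔ big ⊨ ψ [ e′ ]
        bridge u eq eq′ ψ = mk⇔
          (to (⊨-rename big eq′ ψ) ∘ to (⊨-rename big split (rename u ψ)) ∘ proj₁ r≐
             ∘ realizes-⊇ r c⊨r {rename u ψ} ∘ from (⊨-rename M eq ψ))
          (to (⊨-rename M eq ψ) ∘ c⊨r {rename u ψ}
             ∘ proj₂ r≐ ∘ from (⊨-rename big split (rename u ψ)) ∘ from (⊨-rename big eq′ ψ))
          where
          split : [ b′ , ι ]′ ∘ map₂ [ a , z ]′ ≗ [ b′ , ι ∘ [ a , z ]′ ]′
          split (inj₁ _) = refl
          split (inj₂ _) = refl

      -- The sequence `b` has this property in `big`, and `bridge` brings it down. Supports are made
      -- finite first because `MorleySequenceOverM` is phrased for finitely many parameters.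
      power-realizes : ∀ i → Realizes p (λ y → c (i , y))
                       [ z , (λ (((j , _) , y) : Before {m} i × V) → c (j , y)) ]′
      power-realizes i {φ} pφ with finite-support φ
      ... | k , e , φ₀ , refl =
        from (⊨-rename M eqφ φ₀) (from (bridge u eq₁ eq₂ φ₀)
          (morley i φ₀ (class ∘ e)
            -- The witness for `InExtension` is the parameter tuple in `M` itself: by `bridge` it
            -- has the type over `a` of its counterpart in `big`.
            (d ∘ e , ((λ {ψ} → to (bridge u′ eq₃ eq₄ ψ)) , (λ {ψ} → from (bridge u′ eq₃ eq₄ ψ))) ,
             subst (pred p) (rename-≗ eqp φ₀) pφ)))
        where
        Params : Set ℓ
        Params = I ⊎ (Z ⊎ (Before {m} i × V))
        d : Params → ∣M∣
        d = [ a , [ z , (λ ((j , _) , y) → c (j , y)) ]′ ]′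
        class : Params → ∣M∣ ⊎ (Before {m} i × V)
        class (inj₁ i)        = inj₁ (a i)
        class (inj₂ (inj₁ ζ)) = inj₁ (z ζ)
        class (inj₂ (inj₂ b)) = inj₂ b
        place : Params → (Position m × V) ⊎ (I ⊎ Z)
        place (inj₁ i)                    = inj₂ (inj₁ i)
        place (inj₂ (inj₁ ζ))             = inj₂ (inj₂ ζ)
        place (inj₂ (inj₂ ((j , _) , y))) = inj₁ (j , y)
        placeM : [ c , [ a , z ]′ ]′ ∘ place ≗ d
        placeM (inj₁ _)        = refl
        placeM (inj₂ (inj₁ _)) = refl
        placeM (inj₂ (inj₂ _)) = refl
        placeBig : [ b′ , ι ∘ [ a , z ]′ ]′ ∘ place ≗ [ ι , initial {m} b i ]′ ∘ class
        placeBig (inj₁ _)        = refl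
        placeBig (inj₂ (inj₁ _)) = refl
        placeBig (inj₂ (inj₂ _)) = refl
        u : V ⊎ Fin k → (Position m × V) ⊎ (I ⊎ Z)
        u = [ (λ y → inj₁ (i , y)) , place ∘ e ]′
        u′ : Fin k ⊎ I → (Position m × V) ⊎ (I ⊎ Z)
        u′ = [ place ∘ e , inj₂ ∘ inj₁ ]′
        eq₁ : [ c , [ a , z ]′ ]′ ∘ u ≗ [ (λ y → c (i , y)) , d ∘ e ]′
        eq₁ (inj₁ _) = refl
        eq₁ (inj₂ s) = placeM (e s)
        eq₂ : [ b′ , ι ∘ [ a , z ]′ ]′ ∘ u ≗ [ b i , [ ι , initial {m} b i ]′ ∘ class ∘ e ]′
        eq₂ (inj₁ _) = refl
        eq₂ (inj₂ s) = placeBig (e s)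
        eq₃ : [ c , [ a , z ]′ ]′ ∘ u′ ≗ [ d ∘ e , a ]′
        eq₃ (inj₁ s) = placeM (e s)
        eq₃ (inj₂ _) = refl
        eq₄ : [ b′ , ι ∘ [ a , z ]′ ]′ ∘ u′ ≗ [ [ ι , initial {m} b i ]′ ∘ class ∘ e , ι ∘ a ]′
        eq₄ (inj₁ s) = placeBig (e s)
        eq₄ (inj₂ _) = refl
        eqφ : [ (λ y → c (i , y)) , d ]′ ∘ map₂ e ≗ [ (λ y → c (i , y)) , d ∘ e ]′
        eqφ (inj₁ _) = refl
        eqφ (inj₂ _) = refl
        eqp : map₂ d ∘ map₂ e ≗ map₂ (d ∘ e)
        eqp (inj₁ _) = refl
        eqp (inj₂ _) = refl

      power-morley : ∀ l l≤m → Morley p [ c , z ]′ (Range inj₂) (map (λ i y → inj₁ (i , y)) (positions m l l≤m))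
      power-morley = morley-positions p {m = m} _ λ i → realizes-reindex p (power-realizes i)
        (λ { (_ , inj₁ (ζ , _))     → inj₁ ζ
           ; (_ , inj₂ (j , y , _)) → inj₂ (j , y) })
        (λ { (_ , inj₁ (ζ , refl))     → refl
           ; (_ , inj₂ (j , y , refl)) → refl })

    -- Doubling a tuple.

    not-both : (P : InvariantType M a V) → ∀ {φ} → pred P φ → ¬ pred P (not φ)
    not-both P Pφ P¬φ with IsType.finSat (isType P) (_ ∷ _ ∷ []) (Pφ ∷ P¬φ ∷ [])
    ... | _ , φy ∷ ¬φy ∷ [] = refute (¬φy φy)

    InvIndep⇒realizes : (P : InvariantType M a V) {x : V → ∣M∣} {d : J → ∣M∣} →
                        tp M x [ a , d ]′ ⊆ _↾_ M (pred P) [ a , d ]′ → Realizes P x d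
    InvIndep⇒realizes P ⊆P {φ} Pφ = dne λ ¬φx →
      not-both P Pφ (⊆P {not φ} (λ φx → ⊥-elim (¬φx φx)))

    record Doubling {Z : Set ℓ} (z : Z → ∣M∣) (w : Fin 2 → Z → ∣M∣) : Set (lsuc (lsuc ℓ)) where
      field
        copy     : ∀ i → z ≣ w i
        sequence : InvariantSequence M a 2 w

    pair : (Z → ∣M∣) → (Z → ∣M∣) → Fin 2 → Z → ∣M∣
    pair z z′ 0F = z
    pair z z′ 1F = z′

    -- `P` extends the type of `z` over `a`, so `z′` is a copy of `z`; `P` also witnesses both
    -- independences, of `z` from the empty tuple and of `z′` from `z`.
    pair-doubling : (P : InvariantType M a Z) {z z′ : Z → ∣M∣} → tp M z a ⊆ _↾_ M (pred P) a →
                    Realizes P z′ z → Doubling z (pair z z′)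
    pair-doubling {Z} P {z} {z′} tp⊆P z′⊨P = record
      { copy     = copies
      ; sequence = (λ i j _ → let i≣j = ≣-trans (≣-sym (copies i)) (copies j) in
                      (λ {φ} → ≣⇒tp⊆ i≣j {φ}) , (λ {φ} → ≣⇒tp⊆ (≣-sym i≣j) {φ})) , indep
      }
      where
      copies : ∀ i → z ≣ pair z z′ i
      copies 0F = ≣-refl
      copies 1F = tp⊆⇒≣ λ {φ} φz → realizes⇒⊆tp P z′⊨P {φ} (tp⊆P φz)
      indep : ∀ i → InvIndep M (pair z z′ i) a (initial {fin 2} (pair z z′) i)
      indep 0F = tp⊆⇒InvIndep P tp⊆P λ ()
      indep 1F = InvIndep-reindex (realizes⇒InvIndep P z′⊨P) proj₂ λ
        { ((0F , _) , ζ) → refl ; ((1F , s≤s ()) , ζ) }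

    -- The common abstraction of strong bi-invariance and semi-reliability.
    -- `place` reconciles two orders: an invariant sequence (w 0F , w 1F) has its
    -- lower (left) copy first in the former case and last in the latter.
    record Side {V : Set ℓ} (p : InvariantType M a V) (m : Length) : Set (lsuc (lsuc (lsuc ℓ))) where
      field
        State  : {Z : Set ℓ} → (Z → ∣M∣) → Set (lsuc (lsuc ℓ))
        Tracks : {Z : Set ℓ} {z : Z → ∣M∣} → State z → (V → Z) → Set (lsuc ℓ)
        place  : Fin 2 → Fin 2
        start  : {b : V → ∣M∣} → tp M b a ⊆ _↾_ M (pred p) a → Σ[ s ∈ State b ] Tracks s id
        push   : {Z : Set ℓ} {z : Z → ∣M∣} (s : State z) {w : Fin 2 → Z → ∣M∣} → Doubling z w →
                 Σ[ s′ ∈ State (uncurry w) ] ∀ i {h} → Tracks s h → Tracks s′ ((i ,_) ∘ h)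
        double : {Z : Set ℓ} {z : Z → ∣M∣} (s : State z) →
                 Σ[ w ∈ (Fin 2 → Z → ∣M∣) ] Doubling z w ×
                   (∀ A → length A ≤ᴸ m → All (Tracks s) A → Morley p z ∅ A →
                    Morley p (uncurry w) (Range (place 1F ,_)) (map ((place 0F ,_) ∘_) A))

    -- Doubling for strongly bi-invariant types.

    corr-pointwise : (hs : List (V → Z)) (hs′ : List (V → Z′)) → length hs ≡ length hs′ →
                     Pointwise (λ h h′ → ∀ y → Corr hs hs′ (h y) (h′ y)) hs hs′
    corr-pointwise []       []         _  = []
    corr-pointwise (h ∷ hs) (h′ ∷ hs′) eq =
      here ∷ Pointwise.map (there ∘_) (corr-pointwise hs hs′ (suc-injective eq))

    module _ {V : Set ℓ} {p : InvariantType M a V} {m : Length} (strong : StronglyBiInvariant M m p) where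

      private
        r : InvariantType M a (Position m × V)
        r = proj₁ strong

        power : IsPower M p m r
        power = proj₁ (proj₂ strong)

        bi : BiInvariant M r
        bi = proj₂ (proj₂ strong)

      module _ {Z : Set ℓ} {z d : Z → ∣M∣} {c : Position m × V → ∣M∣} (c⊨r : Realizes r c z)
               (t : InvariantType M a Z) (z⊨t : Realizes t z c) (d⊨t : Realizes t d z)
               {A : List (V → Z)} (l≤m : length A ≤ᴸ m) (mA : Morley p z ∅ A) where

        private
          y : (Position m × V) ⊎ Z → ∣M∣
          y = [ c , z ]′

          C : List (V → (Position m × V) ⊎ Z)
          C = map (λ i v → inj₁ (i , v)) (positions m (length A) l≤m)

          mC : Morley p y (Range inj₂) C
          mC = power-morley {p = p} {r = r} power c⊨r (length A) l≤m

          cover-C : ∀ {η} → Cover C η → Range inj₁ η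
          cover-C = go (positions m (length A) l≤m)
            where
            go : ∀ is {η} → Cover (map (λ i v → inj₁ (i , v)) is) η → Range inj₁ η
            go (i ∷ is) (here (v , eq)) = (i , v) , eq
            go (i ∷ is) (there c)       = go is c

          -- Matches the initial segment `C` of `c` with `A` in the lower copy, and `z` with the
          -- upper copy `d`.
          data Rel : (Position m × V) ⊎ Z → Fin 2 × Z → Set ℓ where
            lower : ∀ {η ζ} → Corr C A η ζ → Rel η (0F , ζ)
            upper : ∀ {ζ} → Rel (inj₂ ζ) (1F , ζ)

          -- A and C have the same type over a, and t is a-invariant, so
          -- (d, A) and (z, C) have the same type over a.
          elementary : Elementary y (uncurry (pair z d)) Rel
          elementary = ≣-reindex
            (realizes-unique t
              (realizes-reindex t z⊨t (λ (_ , _ , κ) → proj₁ (cover-C (corr-cover₁ κ)))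
                (λ (_ , _ , κ) → cong y (sym (proj₂ (cover-C (corr-cover₁ κ))))))
              (realizes-reindex t d⊨t π₂ (λ _ → refl))
              (morley-unique p mC mA))
            split eq eq′
            where
            split : Graph Rel → Z ⊎ Graph (Corr C A)
            split (_ , _ , lower κ)       = inj₂ (_ , _ , κ)
            split (_ , _ , upper {ζ = ζ}) = inj₁ ζ
            eq : [ z , y ∘ π₁ ]′ ∘ split ≗ y ∘ π₁
            eq (_ , _ , lower κ) = refl
            eq (_ , _ , upper)   = refl
            eq′ : [ d , z ∘ π₂ ]′ ∘ split ≗ uncurry (pair z d) ∘ π₂
            eq′ (_ , _ , lower κ) = refl
            eq′ (_ , _ , upper)   = refl

        -- `C` is Morley over `z`; `elementary` carries this to `A` over `d`.
        pair-morley : Morley p (uncurry (pair z d)) (Range (1F ,_)) (map ((0F ,_) ∘_) A)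
        pair-morley = morley-transfer p elementary
          (λ { (ζ , refl) → inj₂ ζ , (ζ , refl) , upper })
          (pointwise (corr-pointwise C A (length-map-positions m _ (length A) l≤m)))
          mC
          where
          pointwise : ∀ {hs hs′} → Pointwise (λ h h′ → ∀ v → Corr C A (h v) (h′ v)) hs hs′ →
                      Pointwise (λ h h′ → ∀ v → Rel (h v) (h′ v)) hs (map ((0F ,_) ∘_) hs′)
          pointwise []       = []
          pointwise (κ ∷ κs) = (lower ∘ κ) ∷ pointwise κs

      strongSide : Side p m
      strongSide = record
        { State  = λ _ → Poly.⊤
        ; Tracks = λ _ _ → Poly.⊤
        ; place  = id
        ; start  = λ _ → _
        ; push   = λ _ _ → _
        ; double = λ {_} {z} _ →
            let (c , c⊨r) = realization r z
                (t , ⊆t)  = bi z c (λ {φ} → c⊨r {φ})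
                (d , d⊨t) = realization t z
            in pair z d , pair-doubling t (InvIndep⇒tp⊆ t ⊆t) d⊨t ,
               λ A l≤m _ → pair-morley c⊨r t (InvIndep⇒realizes t ⊆t) d⊨t l≤m
        }

    -- Doubling for semi-reliable types.

    module _ {V : Set ℓ} {p : InvariantType M a V} (semiReliable : SemiReliable M p) where

      private
        R : {W : Set ℓ} → InvariantType M a W → Set (lsuc (lsuc ℓ))
        R = proj₁ semiReliable

        closed : SemiReliablyClosed M a R
        closed = proj₁ (proj₂ semiReliable)

        Rp : R p
        Rp = proj₂ (proj₂ semiReliable)

        record State {Z : Set ℓ} (z : Z → ∣M∣) : Set (lsuc (lsuc ℓ)) where
          constructor state
          field
            type    : InvariantType M a Z
            inR     : R type
            extends : tp M z a ⊆ _↾_ M (pred type) a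

        open State

        Tracks : {z : Z → ∣M∣} → State z → (V → Z) → Set (lsuc ℓ)
        Tracks s h = ∀ φ → pred p φ → pred (type s) (rename (map₁ h) φ)

        start : {b : V → ∣M∣} → tp M b a ⊆ _↾_ M (pred p) a → Σ[ s ∈ State b ] Tracks s id
        start tp⊆p = state p Rp tp⊆p , λ φ pφ → subst (pred p) (sym (renamed φ)) pφ
          where
          map₁-id : map₁ {A = V} {B = ∣M∣} id ≗ id
          map₁-id (inj₁ _) = refl
          map₁-id (inj₂ _) = refl
          renamed : ∀ φ → rename (map₁ id) φ ≡ φ
          renamed φ = trans (rename-cong map₁-id φ) (rename-id φ)

        push : {z : Z → ∣M∣} (s : State z) {w : Fin 2 → Z → ∣M∣} → Doubling z w →
               Σ[ s′ ∈ State (uncurry w) ] ∀ i {h} → Tracks s h → Tracks s′ ((i ,_) ∘ h)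
        push {Z} {z} (state P RP tp⊆P) {w} dbl
          -- The number 1 stands for sequences of length two, whose type over `a` is taken to be
          -- that of `w` itself.
          with closed P RP 1 (tp M (uncurry w) a) isType-w extends-P
                 (w , Doubling.sequence dbl , (λ {_} → id) , (λ {_} → id))
          where
          isType-w : IsType M a (tp M (uncurry w) a)
          isType-w = record
            { finSat   = λ _ φs → uncurry w , φs
            ; complete = λ φ → case em {P = tp M (uncurry w) a φ} of λ
                { (yes φw) → inj₁ φw
                ; (no ¬φw) → inj₂ (λ φw → ⊥-elim (¬φw φw)) }
            }
          eq : [ uncurry w , a ]′ ∘ map₁ (0F ,_) ≗ [ w 0F , a ]′
          eq (inj₁ _) = refl
          eq (inj₂ _) = refl
          extends-P : ∀ φ → _↾_ M (pred P) a φ → tp M (uncurry w) a (rename (map₁ (0F ,_)) φ)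
          extends-P φ Pφ = from (⊨-rename M eq φ)
            -- `P` restricted to `a` is exactly the complete type of `z`, and `w 0F` is a copy of
            -- `z`.
            (≣⇒tp⊆ (Doubling.copy dbl 0F) {φ} (dne λ ¬φz →
              not-both P Pφ (tp⊆P {not φ} (λ φz → ⊥-elim (¬φz φz)))))
        ... | r , Rr , P⊆r , tp⊆r = state r Rr tp⊆r , λ i {h} tracks φ pφ →
          subst (pred r) (rename-≗ (eq i h) φ) (P⊆r i _ (tracks φ pφ))
          where
          eq : ∀ i (h : V → Z) → map₁ {B = ∣M∣} (i ,_) ∘ map₁ h ≗ map₁ ((i ,_) ∘ h)
          eq i h (inj₁ _) = refl
          eq i h (inj₂ _) = refl

        tracks⇒realizes : {z z′ : Z → ∣M∣} (s : State z) {d : J → ∣M∣} → Realizes (type s) z′ d →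
                          ∀ {h} → Tracks s h → Realizes p (z′ ∘ h) d
        tracks⇒realizes {z′ = z′} s {d} z′⊨P {h} tracks {φ} pφ =
          to (⊨-rename M eqM φ) (z′⊨P {rename (map₁ h) φ}
            (subst (pred (type s)) (trans (rename-≗ commute φ) (sym (rename-∘ _ _ φ))) (tracks _ pφ)))
          where
          commute : map₁ h ∘ map₂ [ a , d ]′ ≗ map₂ [ a , d ]′ ∘ map₁ h
          commute (inj₁ _) = refl
          commute (inj₂ _) = refl
          eqM : [ z′ , [ a , d ]′ ]′ ∘ map₁ h ≗ [ z′ ∘ h , [ a , d ]′ ]′
          eqM (inj₁ _) = refl
          eqM (inj₂ _) = refl

        double : {z : Z → ∣M∣} (s : State z) →
                 Σ[ w ∈ (Fin 2 → Z → ∣M∣) ] Doubling z w ×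
                   (∀ A → length A ≤ᴸ fin 1 → All (Tracks s) A → Morley p z ∅ A →
                    Morley p (uncurry w) (Range (0F ,_)) (map ((1F ,_) ∘_) A))
        double {Z} {z} s with realization (type s) z
        ... | d , d⊨P = pair z d , pair-doubling (type s) (extends s) d⊨P , morley
          where
          morley : ∀ A → length A ≤ᴸ fin 1 → All (Tracks s) A → Morley p z ∅ A →
                   Morley p (uncurry (pair z d)) (Range (0F ,_)) (map ((1F ,_) ∘_) A)
          morley []          _        _            _ = []
          -- The bound 1 allows a single member: `d` realizes the type of the state over `z`, hence
          -- `p` over `z` in every tracked position.
          morley (h ∷ [])    _        (tracks ∷ _) _ =
            realizes-reindex p (tracks⇒realizes s d⊨P tracks)
              (λ { (_ , inj₁ (ζ , _)) → ζ }) (λ { (_ , inj₁ (ζ , refl)) → refl })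
            ∷ []
          morley (_ ∷ _ ∷ _) (s≤s ()) _            _

      semiReliableSide : Side p (fin 1)
      semiReliableSide = record
        { State  = State
        ; Tracks = Tracks
        ; place  = opposite
        ; start  = start
        ; push   = push
        ; double = double
        }

    -- Trees of finite depth.

    module _ {V : Set ℓ} where

      morley-copy : (p : InvariantType M a V) {z : Z → ∣M∣} {w : Fin 2 → Z → ∣M∣} → Doubling z w → ∀ i →
                    ∀ {A} → Morley p z ∅ A → Morley p (uncurry w) ∅ (map ((i ,_) ∘_) A)
      morley-copy p dbl i = morley-image p (i ,_) (Doubling.copy dbl i)

      cover-range : (i : Fin 2) (B : List (V → Z)) → Cover (map ((i ,_) ∘_) B) ⊆ Range (i ,_)
      cover-range i (_ ∷ B) (here (y , eq)) = _ , eq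
      cover-range i (_ ∷ B) (there c)       = cover-range i B c

      module Trees {p q : InvariantType M a V} {m n : Length} (sideᵖ : Side p m) (sideᵠ : Side q n) where

        private
          module P = Side sideᵖ
          module Q = Side sideᵠ

        -- One tuple `z` holds all parameters of the tree at once. Nodes are indexed by infinite
        -- branches, of which the trees built below read only the first `N` entries; so trees of all
        -- depths share one index type.
        record Tree (N : ℕ) : Set (lsuc (lsuc ℓ)) where
          field
            {Slot}  : Set ℓ
            z       : Slot → ∣M∣
            node    : 2²^ω → V → Slot
            stateᵖ  : P.State z
            stateᵠ  : Q.State z
            tracksᵖ : ∀ σ → P.Tracks stateᵖ (node σ)
            tracksᵠ : ∀ σ → Q.Tracks stateᵠ (node σ)
            up      : ∀ {C} → Comb (NarrowlyWithin below above N) m C → Morley p z ∅ (map node C)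
            right   : ∀ {C} → Comb (NarrowlyWithin leftOf rightOf N) n C → Morley q z ∅ (map node C)

        root : {b : V → ∣M∣} → tp M b a ⊆ _↾_ M (pred p) a → tp M b a ⊆ _↾_ M (pred q) a → Tree 0
        root {b} b⊨p b⊨q = record
          { z       = b
          ; node    = λ _ → id
          ; stateᵖ  = proj₁ (P.start b⊨p)
          ; stateᵠ  = proj₁ (Q.start b⊨q)
          ; tracksᵖ = λ _ → proj₂ (P.start b⊨p)
          ; tracksᵠ = λ _ → proj₂ (Q.start b⊨q)
          ; up      = trivial p b⊨p
          ; right   = trivial q b⊨q
          }
          where
          trivial : ∀ (r : InvariantType M a V) {lo hi l C} → tp M b a ⊆ _↾_ M (pred r) a →
                    Comb (NarrowlyWithin lo hi 0) l C → Morley r b ∅ (map (λ _ → id) C)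
          trivial r b⊨r c with comb-depth-0 _ _ c
          ... | σ , refl = InvIndep⇒realizes r
            (proj₂ (tp⊆⇒InvIndep r b⊨r λ { (_ , inj₁ ()) ; (_ , inj₂ ()) })) ∷ []

        module _ {N : ℕ} (T : Tree N) where
          open Tree T

          private
            -- The tuple is doubled vertically for `p`, and the resulting pair horizontally for `q`;
            -- both states are pushed through both doublings.
            doubleᵖ = P.double stateᵖ
            w₁ = proj₁ doubleᵖ
            dbl₁ = proj₁ (proj₂ doubleᵖ)
            joinᵖ = proj₂ (proj₂ doubleᵖ)

            pushᵖ₁ = P.push stateᵖ dbl₁
            pushᵠ₁ = Q.push stateᵠ dbl₁

            doubleᵠ = Q.double (proj₁ pushᵠ₁)
            w₂ = proj₁ doubleᵠ
            dbl₂ = proj₁ (proj₂ doubleᵠ)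
            joinᵠ = proj₂ (proj₂ doubleᵠ)

            pushᵖ₂ = P.push (proj₁ pushᵖ₁) dbl₂
            pushᵠ₂ = Q.push (proj₁ pushᵠ₁) dbl₂

            row : Fin 2 → (V → Slot) → V → Fin 2 × Slot
            row j = (P.place j ,_) ∘_

            column : Fin 2 → (V → Fin 2 × Slot) → V → Fin 2 × (Fin 2 × Slot)
            column i = (Q.place i ,_) ∘_

            -- The tree grows at its root: the first entry chooses one of four copies of the old
            -- tree, and the shifted branch is read there.
            node′ : 2²^ω → V → Fin 2 × (Fin 2 × Slot)
            node′ σ = column (proj₁ (σ 0)) (row (proj₂ (σ 0)) (node (shift σ)))

            nodes : List 2²^ω → List (V → Slot)
            nodes C = map node (map shift C)

            node′-nodes : ∀ {i j C} → All (StartsWith (i , j)) C →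
                          map node′ C ≡ map (column i) (map (row j) (nodes C))
            node′-nodes []          = refl
            node′-nodes (refl ∷ tC) = cong (_ ∷_) (node′-nodes tC)

            copies : (r : InvariantType M a V) → ∀ i j {C} → All (StartsWith (i , j)) C →
                     Morley r z ∅ (nodes C) → Morley r (uncurry w₂) ∅ (map node′ C)
            copies r i j tC mC rewrite node′-nodes tC =
              morley-copy r dbl₂ (Q.place i) (morley-copy r dbl₁ (P.place j) mC)

            up′ : ∀ {C} → Comb (NarrowlyWithin below above (suc N)) m C →
                  Morley p (uncurry w₂) ∅ (map node′ C)
            up′ c with decompose below above (λ _ ()) c
            ... | inside (i , j) tC cC = copies p i j tC (up cC)
            ... | straddle {A} {B} i tA tB A≤m cA cB
              rewrite map-++ node′ A B | node′-nodes tA | node′-nodes tB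
                    | sym (map-++ (column i) (map (row 0F) (nodes A)) (map (row 1F) (nodes B))) =
              -- Both parts lie in column `i`, so they are joined inside the vertical pair, and the
              -- result is copied to that column.
              morley-copy p dbl₂ (Q.place i)
                (morley-++ p (cover-range (P.place 1F) (nodes B))
                  (joinᵖ (nodes A) (subst (_≤ᴸ m) (sym (length-nodes A)) A≤m) (tracks (map shift A)) (up cA))
                  (morley-copy p dbl₁ (P.place 1F) (up cB)))
              where
              length-nodes : ∀ C → length (nodes C) ≡ length C
              length-nodes C = trans (length-map node (map shift C)) (length-map shift C)
              tracks : ∀ C → All (P.Tracks stateᵖ) (map node C)
              tracks C = All.map⁺ (All.universal tracksᵖ C)

            right′ : ∀ {C} → Comb (NarrowlyWithin leftOf rightOf (suc N)) n C →
                     Morley q (uncurry w₂) ∅ (map node′ C)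
            right′ c with decompose leftOf rightOf (λ _ ()) c
            ... | inside (i , j) tC cC = copies q i j tC (right cC)
            ... | straddle {A} {B} j tA tB A≤n cA cB
              rewrite map-++ node′ A B | node′-nodes tA | node′-nodes tB =
              -- Both parts lie in row `j`, so they are first copied to that row of the vertical
              -- pair; the join then uses the horizontal doubling.
              morley-++ q (cover-range (Q.place 1F) (map (row j) (nodes B)))
                (joinᵠ (map (row j) (nodes A)) (subst (_≤ᴸ n) (sym (length-nodes A)) A≤n)
                  (tracks (map shift A)) (morley-copy q dbl₁ (P.place j) (right cA)))
                (morley-copy q dbl₂ (Q.place 1F) (morley-copy q dbl₁ (P.place j) (right cB)))
              where
              length-nodes : ∀ C → length (map (row j) (nodes C)) ≡ length C
              length-nodes C = trans (length-map (row j) (nodes C))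
                (trans (length-map node (map shift C)) (length-map shift C))
              tracks : ∀ C → All (Q.Tracks (proj₁ pushᵠ₁)) (map (row j) (map node C))
              tracks C = All.map⁺ (All.map⁺ (All.universal (λ σ → proj₂ pushᵠ₁ (P.place j) (tracksᵠ σ)) C))

          grow : Tree (suc N)
          grow = record
            { z       = uncurry w₂
            ; node    = node′
            ; stateᵖ  = proj₁ pushᵖ₂
            ; stateᵠ  = proj₁ pushᵠ₂
            ; tracksᵖ = λ σ → proj₂ pushᵖ₂ _ (proj₂ pushᵖ₁ _ (tracksᵖ (shift σ)))
            ; tracksᵠ = λ σ → proj₂ pushᵠ₂ _ (proj₂ pushᵠ₁ _ (tracksᵠ (shift σ)))
            ; up      = up′
            ; right   = right′
            }

    -- Passage to depth ω.

    -- Saturation realizes the set of all formulas that eventually hold.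
    limit : (c : ℕ → K → ∣M∣) → Σ[ d ∈ (K → ∣M∣) ]
            ∀ {J : Set ℓ} (k : J → K) {y : J → ∣M∣} →
            (∃[ N₀ ] ∀ {N} → N₀ ≤ N → c N ∘ k ≣ y) → d ∘ k ≣ y
    limit {K} c with saturated {V = K} a Eventually finSat
      where
      Eventually : Pred (Formula L (K ⊎ I)) (lsuc ℓ)
      Eventually φ = ∃[ N₀ ] ∀ {N} → N₀ ≤ N → tp M (c N) a φ
      together : ∀ {φs} → All Eventually φs → ∃[ N₀ ] ∀ {N} → N₀ ≤ N → All (tp M (c N) a) φs
      together [] = 0 , λ _ → []
      together ((N₁ , h₁) ∷ evs) with together evs
      ... | N₂ , h₂ = N₁ ⊔ₙ N₂ , λ N₀≤N →
        h₁ (≤-trans (m≤m⊔n N₁ N₂) N₀≤N) ∷ h₂ (≤-trans (m≤n⊔m N₁ N₂) N₀≤N)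
      finSat : FinitelySatisfiable M a Eventually
      finSat φs evs = let (N₀ , h) = together evs in c N₀ , h ≤-refl
    ... | d , d⊨ = d , λ {J} k {y} (N₀ , same) → ≣-sym (tp⊆⇒≣ λ {φ} φy →
      to (⊨-rename M (restrict d k) φ) (d⊨ {rename (map₁ k) φ} (N₀ , λ {N} N₀≤N →
        from (⊨-rename M (restrict (c N) k) φ) (≣⇒tp⊆ (≣-sym (same N₀≤N)) {φ} φy))))
      where
      restrict : ∀ {J : Set ℓ} (e : K → ∣M∣) (k : J → K) → [ e , a ]′ ∘ map₁ k ≗ [ e ∘ k , a ]′
      restrict e k (inj₁ _) = refl
      restrict e k (inj₂ _) = refl

    satisfied-transfer : ∀ {s t k} {S : Set s} {T : Set t} {c : S → V → ∣M∣} {d : T → V → ∣M∣}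
      (φ : Formula L (Fin k ⊎ V)) (F : Automorphism M) →
      ∀ {is js} → Pointwise (λ i j → Automorphism.to F ∘ c i ≗ d j) is js →
      Satisfied M φ c is → Satisfied M φ d js
    satisfied-transfer {c = c} {d} φ F same (x , φx) = Automorphism.to F ∘ x , go same φx
      where
      maps : ∀ {i j} → Automorphism.to F ∘ c i ≗ d j →
             Automorphism.to F ∘ [ x , c i ]′ ≗ [ Automorphism.to F ∘ x , d j ]′
      maps eq (inj₁ _) = refl
      maps eq (inj₂ y) = eq y
      go : ∀ {is js} → Pointwise (λ i j → Automorphism.to F ∘ c i ≗ d j) is js →
           All (λ i → M ⊨ φ [ [ x , c i ]′ ]) is →
           All (λ j → M ⊨ φ [ [ Automorphism.to F ∘ x , d j ]′ ]) js
      go []          []         = []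
      go (eq ∷ same) (φi ∷ φis) = to (automorphism-⊨ F (maps eq) φ) φi ∷ go same φis

    -- Weaves from failures of Kim's lemma.

    module _ {V : Set ℓ} {p q : InvariantType M a V} {k : ℕ} {m n : Length}
             (sideᵖ : Side p m) (sideᵠ : Side q n) where

      open Trees sideᵖ sideᵠ

      -- Pairs the member of `C` numbered `i` with the term of index `i` of a sequence.
      Entry : List 2²^ω → 2²^ω × V → ℕ × V → Set ℓ
      Entry C = Corr (map _,_ C) (map _,_ (positions ω (length C) tt))

      at-entry : ∀ {C σ i} → At C σ i → ∀ y → Entry C (σ , y) (i , y)
      at-entry here        y = here y
      at-entry (there σ↦i) y = there (at-entry σ↦i y)

      -- In the limit tree a comb has the type over `a` of an initial segment of any Morley
      -- sequence, in `p` for up-combs and in `q` for right-combs. Thus k-inconsistency along `p`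
      -- and consistency along `q` pass to the leaves.
      kim-failure⇒weave : ∀ {x} (φ : Formula L (Fin x ⊎ V)) {b : V → ∣M∣} →
        tp M b a ⊆ _↾_ M (pred p) a → tp M b a ⊆ _↾_ M (pred q) a →
        KDividesAlong M φ p k → ¬ DividesAlong M φ q → Weave M k m n
      -- A weave has finite parameter tuples, so only the finitely many variables of `V` occurring
      -- in the formula are kept.
      kim-failure⇒weave φ b⊨p b⊨q (bᵖ , morleyᵖ , k-inconsistent) ¬divides with finite-support φ
      ... | _ , e , φ₀ , refl = record
        { φ     = φ₀
        ; b     = λ σ → leaf σ ∘ e
        ; up    = λ C comb is unique length≡k is⊆C sat →
            let (_ , is↦js) = at-all is⊆C in
            k-inconsistent _ (at-unique unique is↦js) (trans (sym (Pointwise-length is↦js)) length≡k)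
              (All.universal (λ _ → tt) _)
              (transport (uniform p Tree.up (comb-within below above comb) morleyᵖ) is↦js
                (to (satisfied-rename _) sat))
        ; right = λ C comb is is⊆C →
            let (_ , is↦js) = at-all is⊆C in
            from (satisfied-rename _)
              (transport⁻ (uniform q Tree.right (comb-within leftOf rightOf comb) morleyᵠ) is↦js
                (consistent _ (All.universal (λ _ → tt) _)))
        }
        where
        tree : ∀ N → Tree N
        tree zero    = root b⊨p b⊨q
        tree (suc N) = grow (tree N)

        approximation : ℕ → 2²^ω × V → ∣M∣
        approximation N (σ , y) = Tree.z (tree N) (Tree.node (tree N) σ y)

        leaf : 2²^ω → V → ∣M∣
        leaf σ y = proj₁ (limit approximation) (σ , y)

        -- All sufficiently deep trees give the comb one and the same type over `a`, by
        -- `morley-unique`, and the limit inherits it.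
        uniform : ∀ (r : InvariantType M a V) {◁ : ℕ → List 2²^ω → List 2²^ω → Set} {l C} →
          (∀ {N} (T : Tree N) {C} → Comb (◁ N) l C → Morley r (Tree.z T) ∅ (map (Tree.node T) C)) →
          (∃[ N₀ ] ∀ {N} → N₀ ≤ N → Comb (◁ N) l C) →
          ∀ {c} → MorleySequence M r c → Elementary (uncurry leaf) (uncurry c) (Entry C)
        uniform r {C = C} morley (N₀ , combs) seq = proj₂ (limit approximation) π₁ (N₀ , λ {N} N₀≤N →
          morley-unique r (relabel N (morley (tree N) (combs N₀≤N))) (sequence-morley r seq (length C)))
          where
          -- The type `Slot` varies with the depth, whereas `limit` needs tuples over a fixed index
          -- type.
          relabel : ∀ N {C} → Morley r (Tree.z (tree N)) ∅ (map (Tree.node (tree N)) C) →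
                    Morley r (approximation N) ∅ (map _,_ C)
          relabel N {C} = morley-transfer r {R = λ { ζ (σ , y) → ζ ≡ Tree.node (tree N) σ y }}
            (≣-reindex ≣-refl π₁ (λ _ → refl) (λ (_ , _ , eq) → cong (Tree.z (tree N)) eq))
            (λ ()) (pointwise C)
            where
            pointwise : ∀ C → Pointwise (λ h h′ → ∀ y → h y ≡ Tree.node (tree N) (proj₁ (h′ y)) (proj₂ (h′ y)))
                                        (map (Tree.node (tree N)) C) (map _,_ C)
            pointwise []      = []
            pointwise (σ ∷ C) = (λ _ → refl) ∷ pointwise C

        transport : ∀ {C c is js} → Elementary (uncurry leaf) (uncurry c) (Entry C) →
                    Pointwise (At C) is js → Satisfied M φ leaf is → Satisfied M φ c js
        transport same is↦js with homogeneous _ _ same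
        ... | F , F-maps = satisfied-transfer φ F
          (Pointwise.map (λ σ↦i y → F-maps (inj₂ (_ , _ , at-entry σ↦i y))) is↦js)

        transport⁻ : ∀ {C c is js} → Elementary (uncurry leaf) (uncurry c) (Entry C) →
                     Pointwise (At C) is js → Satisfied M φ c js → Satisfied M φ leaf is
        transport⁻ same is↦js with homogeneous _ _ (≣-sym same)
        ... | F , F-maps = satisfied-transfer φ F (Pointwise.symmetric
          (λ σ↦i y → F-maps (inj₂ (_ , _ , at-entry σ↦i y))) is↦js)

        satisfied-rename : ∀ is → Satisfied M φ₀ (λ σ → leaf σ ∘ e) is ⇔ Satisfied M φ leaf is
        satisfied-rename is = mk⇔
          (λ (x , φs) → x , All.map (λ {σ} → from (⊨-rename M (eq x σ) φ₀)) φs)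
          (λ (x , φs) → x , All.map (λ {σ} → to (⊨-rename M (eq x σ) φ₀)) φs)
          where
          eq : ∀ (x : Fin _ → ∣M∣) σ → [ x , leaf σ ]′ ∘ map₂ e ≗ [ x , leaf σ ∘ e ]′
          eq x σ (inj₁ _) = refl
          eq x σ (inj₂ _) = refl

        bᵠ = proj₁ (morleySequence q)
        morleyᵠ = proj₂ (morleySequence q)

        consistent : Consistent M φ bᵠ U
        -- Dividing asks for some Morley sequence with inconsistent instances, so its failure makes
        -- the instances along `bᵠ` consistent.
        consistent = dne λ ¬consistent → ¬divides (bᵠ , morleyᵠ , ¬consistent)

  -- By contradiction: without a weave every instance of Kim's lemma holds, since a failing instance
  -- would produce a weave.
  ¬kim⇒weave : ∀ {s t k m n} {𝒳 : Class M s} {𝒴 : Class M t} →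
    (∀ {I V} {a : I → ∣M∣} {p : InvariantType M a V} → 𝒳 p → Over.Side a p m) →
    (∀ {I V} {a : I → ∣M∣} {q : InvariantType M a V} → 𝒴 q → Over.Side a q n) →
    ¬ KimsLemma M k 𝒳 𝒴 → Weave M k m n
  ¬kim⇒weave sideᵖ sideᵠ ¬kim = dne λ ¬weave → ¬kim λ a φ b p q b⊨p b⊨q p∈𝒳 q∈𝒴 k-divides →
    dne λ ¬divides → ¬weave
      (Over.kim-failure⇒weave a (sideᵖ p∈𝒳) (sideᵠ q∈𝒴) φ b⊨p b⊨q k-divides ¬divides)

theorem2p4 : (∀ {e : Level} → ExcludedMiddle e) →
    ∀ {ℓ : Level} (L : Language ℓ) (T : Theory L) → Complete T →
    (M : Structure L) → IsMonster M → M ⊨ₜ T →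
    (k : ℕ) (m n : Length) →
    (¬ KimsLemma M k (StronglyBiInvariant M m) (StronglyBiInvariant M n) → Weave M k m n) ×
    (¬ KimsLemma M k (StronglyBiInvariant M m) (SemiReliable M) → Weave M k m (fin 1)) ×
    (¬ KimsLemma M k (SemiReliable M) (StronglyBiInvariant M n) → Weave M k (fin 1) n) ×
    (¬ KimsLemma M k (SemiReliable M) (SemiReliable M) → Weave M k (fin 1) (fin 1))
theorem2p4 em L T complete M monster M⊨T k m n =
  ¬kim⇒weave strong strong , ¬kim⇒weave strong semi , ¬kim⇒weave semi strong , ¬kim⇒weave semi semi
  where
  open Monster em M monster
  strong : ∀ {l I V} {a : I → Carrier M} {p : InvariantType M a V} →
           StronglyBiInvariant M l p → Over.Side a p l
  strong = Over.strongSide _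
  semi : ∀ {I V} {a : I → Carrier M} {p : InvariantType M a V} →
         SemiReliable M p → Over.Side a p (fin 1)
  semi = Over.semiReliableSide _
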